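{- Let $G$ be a simple, finite, connected graph with vertex set $V=\{v_1,\dots,v_n\}$ and let $M_G$ be a mixed graph with underlying graph $G$ such that every mixed cycle of $M_G$ belongs to the class $\Psi_4$. Then all cofactors of the Hermitian quasi-Laplacian matrix of the second kind $Q(M_G)$ have the same absolute value, and this common absolute value equals the number of spanning trees of $G$.
   Context: A mixed graph $M_G$ is obtained from a simple graph $G$ (its underlying graph) by giving directions to some of the edges of $G$; an edge directed from $v_i$ to $v_j$ is written $v_i\to v_j$, an undirected edge $v_i\leftrightarrow v_j$. Let $\omega=\frac{1+\sqrt{3}\mathbf{i}}{2}$. The Hermitian adjacency matrix of the second kind is the $n\times n$ matrix $N(M_G)=(n_{ij})$ with $n_{ij}=1$ if $v_i\leftrightarrow v_j$, $n_{ij}=\omega$ if $v_i\to v_j$, $n_{ij}=\overline{\omega}$ if $v_j\to v_i$, and $n_{ij}=0$ otherwise. With $D(M_G)$ the diagonal matrix of vertex degrees of $G$, the Hermitian quasi-Laplacian matrix of the second kind is $Q(M_G)=D(M_G)+N(M_G)$. The $(i,j)$ cofactor is $(-1)^{i+j}\det$ of the submatrix obtained by deleting row $i$ and column $j$. A mixed cycle of $M_G$ is the mixed subgraph on a cycle of $G$ (edges keeping their status in $M_G$). For a mixed cycle, fix one of its two cyclic traversal directions and let $a$ be the number of directed edges oriented along the traversal, $b$ the number of directed edges oriented against it, and $c$ the number of undirected edges. The cycle belongs to $\Psi_4$ if $a-b\equiv 0$ or $3 \pmod 6$ and $c$ is even (this does not depend on the chosen traversal direction). -}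

module Defs where

open import Data.Nat as ℕ using (ℕ; zero; suc; _≤_)
open import Data.Nat.Divisibility using (_∣_)
open import Data.Integer as ℤ using (ℤ; +_)
open import Data.Integer.DivMod using (_%ℕ_)
open import Data.Fin using (Fin; zero; suc; toℕ; punchIn; _≟_)
open import Data.List using (List; []; _∷_; length; map; allFin)
open import Data.Nat.ListAction using (sum)
open import Data.List.Relation.Unary.All using (All)
open import Data.List.Relation.Unary.Unique.Propositional using (Unique)
open import Data.Vec using (Vec; lookup)
open import Data.Bool using (Bool; true; false)
open import Data.Product using (_×_; _,_)
open import Data.Sum using (_⊎_)
open import Relation.Binary.PropositionalEquality using (_≡_; _≢_)
open import Relation.Nullary using (yes; no; ¬_)

-- Eisenstein integers ℤ[ω], ω = (1 + √3 i)/2, so ω² = ω - 1 and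
-- ω̄ = 1 - ω.  The element  mkℤω a b  stands for  a + bω.

record ℤω : Set where
  constructor mkℤω
  field
    re : ℤ
    im : ℤ
open ℤω public

0ω 1ω ω ω̄ : ℤω
0ω = mkℤω (+ 0) (+ 0)
1ω = mkℤω (+ 1) (+ 0)
ω  = mkℤω (+ 0) (+ 1)
ω̄  = mkℤω (+ 1) (ℤ.- (+ 1))

fromℕω : ℕ → ℤω
fromℕω k = mkℤω (+ k) (+ 0)

infixl 6 _+ω_
infixl 7 _*ω_

_+ω_ : ℤω → ℤω → ℤω
mkℤω a b +ω mkℤω c d = mkℤω (a ℤ.+ c) (b ℤ.+ d)

-ω_ : ℤω → ℤω
-ω mkℤω a b = mkℤω (ℤ.- a) (ℤ.- b)

-- (a + bω)(c + dω) = (ac - bd) + (ad + bc + bd)ω   using ω² = ω - 1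
_*ω_ : ℤω → ℤω → ℤω
mkℤω a b *ω mkℤω c d =
  mkℤω (a ℤ.* c ℤ.- b ℤ.* d) (a ℤ.* d ℤ.+ b ℤ.* c ℤ.+ b ℤ.* d)

-- |a + bω|² = (a + bω)(a + bω̄) = a² + ab + b²  (the squared absolute value)
absSq : ℤω → ℤ
absSq (mkℤω a b) = a ℤ.* a ℤ.+ a ℤ.* b ℤ.+ b ℤ.* b

Matrix : ℕ → Set
Matrix n = Fin n → Fin n → ℤω

sumFin : ∀ n → (Fin n → ℤω) → ℤω
sumFin zero    f = 0ω
sumFin (suc n) f = f zero +ω sumFin n (λ k → f (suc k))

sign : ℕ → ℤω
sign zero          = 1ω
sign (suc zero)    = -ω 1ω
sign (suc (suc k)) = sign k

det : ∀ n → Matrix n → ℤω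
det zero    A = 1ω
det (suc n) A =
  sumFin (suc n) (λ j → sign (toℕ j) *ω A zero j *ω det n (λ r c → A (suc r) (punchIn j c)))

cofactor : ∀ m → Matrix (suc m) → Fin (suc m) → Fin (suc m) → ℤω
cofactor m A i j =
  sign (toℕ i ℕ.+ toℕ j) *ω det m (λ r c → A (punchIn i r) (punchIn j c))

-- Mixed graphs on vertex set Fin n.
-- M i j = none : no edge; undir : v_i ↔ v_j; fwd : v_i → v_j; bwd : v_j → v_i.

data EdgeSt : Set where
  none undir fwd bwd : EdgeSt

rev : EdgeSt → EdgeSt
rev none  = none
rev undir = undir
rev fwd   = bwd
rev bwd   = fwd

record MixedGraph (n : ℕ) : Set where
  field
    st      : Fin n → Fin n → EdgeSt
    st-rev  : ∀ i j → st j i ≡ rev (st i j)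
    st-loop : ∀ i → st i i ≡ none
open MixedGraph public

Adj : ∀ {n} → MixedGraph n → Fin n → Fin n → Set
Adj M i j = st M i j ≢ none

data Reach {n} (R : Fin n → Fin n → Set) : Fin n → Fin n → Set where
  here : ∀ {i} → Reach R i i
  step : ∀ {i j k} → R i j → Reach R j k → Reach R i k

Connected : ∀ {n} → (Fin n → Fin n → Set) → Set
Connected {n} R = ∀ (i j : Fin n) → Reach R i j

closedPairs : ∀ {n} → List (Fin n) → List (Fin n × Fin n)
closedPairs []       = []
closedPairs (x ∷ xs) = go (x ∷ xs)
  where
  go : List _ → List _
  go []           = []
  go (y ∷ [])     = (y , x) ∷ []
  go (y ∷ z ∷ r)  = (y , z) ∷ go (z ∷ r)

IsCycle : ∀ {n} → (Fin n → Fin n → Set) → List (Fin n) → Set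
IsCycle R vs = 3 ≤ length vs × Unique vs × All (λ p → R (Data.Product.proj₁ p) (Data.Product.proj₂ p)) (closedPairs vs)

countSt : EdgeSt → EdgeSt → ℕ
countSt none  none  = 1
countSt undir undir = 1
countSt fwd   fwd   = 1
countSt bwd   bwd   = 1
countSt _     _     = 0

countAlong : ∀ {n} → MixedGraph n → EdgeSt → List (Fin n) → ℕ
countAlong M s vs = sum (map (λ p → countSt s (st M (Data.Product.proj₁ p) (Data.Product.proj₂ p))) (closedPairs vs))

InΨ₄ : ∀ {n} → MixedGraph n → List (Fin n) → Set
InΨ₄ M vs =
  let a = countAlong M fwd vs
      b = countAlong M bwd vs
      c = countAlong M undir vs
      r = (+ a ℤ.- + b) %ℕ 6
  in (r ≡ 0 ⊎ r ≡ 3) × (2 ∣ c)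

nEntry : EdgeSt → ℤω
nEntry none  = 0ω
nEntry undir = 1ω
nEntry fwd   = ω
nEntry bwd   = ω̄

isEdge : EdgeSt → ℕ
isEdge none = 0
isEdge _    = 1

degree : ∀ {n} → MixedGraph n → Fin n → ℕ
degree {n} M i = sum (map (λ j → isEdge (st M i j)) (allFin n))

Nmat : ∀ {n} → MixedGraph n → Matrix n
Nmat M i j = nEntry (st M i j)

Dmat : ∀ {n} → MixedGraph n → Matrix n
Dmat M i j with i ≟ j
... | yes _ = fromℕω (degree M i)
... | no  _ = 0ω

Qmat : ∀ {n} → MixedGraph n → Matrix n
Qmat M i j = Dmat M i j +ω Nmat M i j

-- Spanning trees of G: edge subsets encoded as symmetric Boolean
-- n×n matrices T, contained in G, connected and without cycles.

TAdj : ∀ {n} → Vec (Vec Bool n) n → Fin n → Fin n → Set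
TAdj T i j = lookup (lookup T i) j ≡ true

IsSpanningTree : ∀ {n} → MixedGraph n → Vec (Vec Bool n) n → Set
IsSpanningTree {n} M T =
    (∀ i j → lookup (lookup T i) j ≡ lookup (lookup T j) i)
  × (∀ i j → TAdj T i j → Adj M i j)
  × Connected (TAdj T)
  × (∀ vs → ¬ IsCycle (TAdj T) vs)

{-# OPTIONS --safe #-}
-- Around a cycle in Ψ₄ the product of the negated entries of N is 1, so N is switching equivalent
-- to minus the adjacency matrix: there are units s with Q_ij = s̄_i L_ij s_j, L the Laplacian of G.
-- Hence |cof_ij Q| = |cof_ij L|, and it remains to count the trees with L.
--
-- Fix a root. Row v of the reduced Laplacian is the sum of e_v − e_w over the neighbours w of v,
-- and the determinant with that row replaced by e_v − e_w is the determinant of the graph in which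
-- v is merged into w. So the determinant counts the parent functions without cycles, which are
-- the spanning trees. As the rows of L sum to zero, cof_ij L does not depend on j, and cof_ii L is
-- the number of spanning trees whatever the root i.
module Submission where

open import Defs
open import Algebra.Bundles using (CommutativeRing)
open import Data.Bool as Bool using (Bool; true; false; _∧_; _∨_; if_then_else_)
open import Data.Bool.Properties using (∨-comm)
open import Data.Empty using (⊥)
open import Data.Fin using (Fin; zero; suc; toℕ; punchIn; _≟_)
open import Data.Fin.Properties using (any?; punchInᵢ≢i)
open import Data.Integer as ℤ using (ℤ; +_; -[1+_])
open import Data.Integer.DivMod using (_%ℕ_; _/ℕ_; a≡a%ℕn+[a/ℕn]*n)
import Data.Integer.Properties as ℤP
import Data.Integer.Tactic.RingSolver as ℤSolver
open import Data.List using (List; []; _∷_; length; concat; tabulate; map; _++_)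
open import Data.List.Membership.Propositional using (_∈_; _∉_)
open import Data.List.Membership.Propositional.Properties using (∈-++⁺ʳ; ∈-map⁺; ∈-map⁻; ∈-concat⁺′; ∈-concat⁻′; ∈-tabulate⁺; ∈-tabulate⁻)
open import Data.List.Membership.Propositional.Properties.WithK using (unique∧set⇒bag)
open import Data.List.Properties using (length-++; length-map)
open import Data.List.Relation.Binary.BagAndSetEquality using (∼bag⇒↭)
open import Data.List.Relation.Binary.Disjoint.Propositional using (Disjoint)
open import Data.List.Relation.Binary.Permutation.Propositional.Properties using (↭-length)
open import Data.List.Relation.Unary.All as All using (All; []; _∷_)
import Data.List.Relation.Unary.All.Properties as All
import Data.List.Relation.Unary.AllPairs.Properties as AllPairs
open import Data.List.Relation.Unary.Any using (here; there)
open import Data.List.Relation.Unary.Unique.Propositional using (Unique; []; _∷_)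
import Data.List.Relation.Unary.Unique.Propositional.Properties as Unique
open import Data.Maybe.Base as Maybe using (Maybe; just; nothing)
open import Data.Maybe.Properties using (just-injective; ≡-dec)
open import Data.Nat as ℕ using (ℕ; zero; suc; _*_; _<_; _≤_; z≤n; s≤s)
open import Data.Nat.Divisibility using (_∣_; divides)
import Data.Nat.ListAction as ℕ
import Data.Nat.Properties as ℕP
open import Data.Product using (_×_; _,_; ∃; ∃₂; proj₁; proj₂; uncurry)
open import Data.Sum as Sum using (_⊎_; inj₁; inj₂)
open import Data.Vec as Vec using (Vec; []; _∷_; lookup)
import Data.Vec.Properties as Vec
open import Function.Base using (_∘_)
open import Function.Bundles using (_⇔_; mk⇔; Equivalence)
open import Level using (0ℓ)
open import Relation.Binary.PropositionalEquality
open import Relation.Nullary using (Dec; yes; no; does; ¬_; contradiction)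
open import Relation.Nullary.Decidable using (_×-dec_; dec-true)
open import Relation.Unary using (Decidable)
open import Tactic.RingSolver using (solve-∀)
open import Tactic.RingSolver.Core.AlmostCommutativeRing using (AlmostCommutativeRing; fromCommutativeRing)
open import Algebra.Definitions {A = ℤω} _≡_ using (Associative; Commutative; LeftIdentity; LeftInverse; _DistributesOverˡ_)

-- The ring of Eisenstein integers

-- The determinant is given by expansion along the first row, and one identity about it,
-- `det-colMerge`, carries the linear algebra: for a block of rows with one column too many, a
-- difference of two signed minors is the determinant obtained by adding one column to another. It
-- serves twice. For rows of sum zero it makes the cofactors along a row equal; for the Laplacian,
-- adding columns is merging vertices, which is the contraction step.
--
-- Absence of cycles in a parent function is expressed by ranks that decrease along it. Ranks pass
-- through contraction in both directions, whereas cyclic vertex lists would have to be rerouted;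
-- such lists enter only in the comparison with spanning trees.
--
-- On the switching side, an undirected edge contributes -1 and directed edges contribute the
-- inverse cube roots of unity `ζ` and `ζ̄`, so the residues 0 and 3 modulo 6 both just say that 3
-- divides a - b. The hypothesis speaks of cycles, but path independence concerns all closed walks;
-- these are reduced to simple ones, where going back and forth along an edge is handled by the
-- Hermitian symmetry of N.

+ω-assoc : Associative _+ω_
+ω-assoc (mkℤω a b) (mkℤω c d) (mkℤω e f) = cong₂ mkℤω (ℤP.+-assoc a c e) (ℤP.+-assoc b d f)

+ω-comm : Commutative _+ω_
+ω-comm (mkℤω a b) (mkℤω c d) = cong₂ mkℤω (ℤP.+-comm a c) (ℤP.+-comm b d)

+ω-identityˡ : LeftIdentity 0ω _+ω_
+ω-identityˡ (mkℤω a b) = cong₂ mkℤω (ℤP.+-identityˡ a) (ℤP.+-identityˡ b)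

-ω-inverseˡ : LeftInverse 0ω -ω_ _+ω_
-ω-inverseˡ (mkℤω a b) = cong₂ mkℤω (ℤP.+-inverseˡ a) (ℤP.+-inverseˡ b)

*ω-assoc : Associative _*ω_
*ω-assoc (mkℤω a b) (mkℤω c d) (mkℤω e f) = cong₂ mkℤω (re-eq a b c d e f) (im-eq a b c d e f)
  where
  re-eq : ∀ a b c d e f → (a ℤ.* c ℤ.- b ℤ.* d) ℤ.* e ℤ.- (a ℤ.* d ℤ.+ b ℤ.* c ℤ.+ b ℤ.* d) ℤ.* f
                        ≡ a ℤ.* (c ℤ.* e ℤ.- d ℤ.* f) ℤ.- b ℤ.* (c ℤ.* f ℤ.+ d ℤ.* e ℤ.+ d ℤ.* f)
  re-eq = ℤSolver.solve-∀
  im-eq : ∀ a b c d e f → (a ℤ.* c ℤ.- b ℤ.* d) ℤ.* f ℤ.+ (a ℤ.* d ℤ.+ b ℤ.* c ℤ.+ b ℤ.* d) ℤ.* e ℤ.+ (a ℤ.* d ℤ.+ b ℤ.* c ℤ.+ b ℤ.* d) ℤ.* f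
                        ≡ a ℤ.* (c ℤ.* f ℤ.+ d ℤ.* e ℤ.+ d ℤ.* f) ℤ.+ b ℤ.* (c ℤ.* e ℤ.- d ℤ.* f) ℤ.+ b ℤ.* (c ℤ.* f ℤ.+ d ℤ.* e ℤ.+ d ℤ.* f)
  im-eq = ℤSolver.solve-∀

*ω-comm : Commutative _*ω_
*ω-comm (mkℤω a b) (mkℤω c d) = cong₂ mkℤω (re-eq a b c d) (im-eq a b c d)
  where
  re-eq : ∀ a b c d → a ℤ.* c ℤ.- b ℤ.* d ≡ c ℤ.* a ℤ.- d ℤ.* b
  re-eq = ℤSolver.solve-∀
  im-eq : ∀ a b c d → a ℤ.* d ℤ.+ b ℤ.* c ℤ.+ b ℤ.* d ≡ c ℤ.* b ℤ.+ d ℤ.* a ℤ.+ d ℤ.* b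
  im-eq = ℤSolver.solve-∀

*ω-identityˡ : LeftIdentity 1ω _*ω_
*ω-identityˡ (mkℤω a b) = cong₂ mkℤω (re-eq a b) (im-eq a b)
  where
  re-eq : ∀ a b → + 1 ℤ.* a ℤ.- + 0 ℤ.* b ≡ a
  re-eq = ℤSolver.solve-∀
  im-eq : ∀ a b → + 1 ℤ.* b ℤ.+ + 0 ℤ.* a ℤ.+ + 0 ℤ.* b ≡ b
  im-eq = ℤSolver.solve-∀

*ω-distribˡ-+ω : _*ω_ DistributesOverˡ _+ω_
*ω-distribˡ-+ω (mkℤω a b) (mkℤω c d) (mkℤω e f) = cong₂ mkℤω (re-eq a b c d e f) (im-eq a b c d e f)
  where
  re-eq : ∀ a b c d e f → a ℤ.* (c ℤ.+ e) ℤ.- b ℤ.* (d ℤ.+ f) ≡ (a ℤ.* c ℤ.- b ℤ.* d) ℤ.+ (a ℤ.* e ℤ.- b ℤ.* f)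
  re-eq = ℤSolver.solve-∀
  im-eq : ∀ a b c d e f → a ℤ.* (d ℤ.+ f) ℤ.+ b ℤ.* (c ℤ.+ e) ℤ.+ b ℤ.* (d ℤ.+ f)
                        ≡ (a ℤ.* d ℤ.+ b ℤ.* c ℤ.+ b ℤ.* d) ℤ.+ (a ℤ.* f ℤ.+ b ℤ.* e ℤ.+ b ℤ.* f)
  im-eq = ℤSolver.solve-∀

ℤω-commutativeRing : CommutativeRing 0ℓ 0ℓ
ℤω-commutativeRing = record
  { Carrier = ℤω ; _≈_ = _≡_ ; _+_ = _+ω_ ; _*_ = _*ω_ ; -_ = -ω_ ; 0# = 0ω ; 1# = 1ω
  ; isCommutativeRing = record
    { isRing = record
      { +-isAbelianGroup = record
        { isGroup = record
          { isMonoid = record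
            { isSemigroup = record
              { isMagma = isMagma _+ω_ ; assoc = +ω-assoc }
            ; identity = comm∧idˡ⇒id +ω-comm +ω-identityˡ }
          ; inverse = comm∧invˡ⇒inv +ω-comm -ω-inverseˡ
          ; ⁻¹-cong = cong -ω_ }
        ; comm = +ω-comm }
      ; *-cong = cong₂ _*ω_
      ; *-assoc = *ω-assoc
      ; *-identity = comm∧idˡ⇒id *ω-comm *ω-identityˡ
      ; distrib = comm∧distrˡ⇒distr (cong₂ _+ω_) *ω-comm *ω-distribˡ-+ω }
    ; *-comm = *ω-comm } }
  where
  open import Algebra.Consequences.Propositional
  open import Relation.Binary.PropositionalEquality.Algebra using (isMagma)

ℤω-ring : AlmostCommutativeRing 0ℓ 0ℓ
ℤω-ring = fromCommutativeRing ℤω-commutativeRing λ { (mkℤω (+ 0) (+ 0)) → just refl ; _ → nothing }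

open CommutativeRing ℤω-commutativeRing using (semiring; +-commutativeMonoid; zeroˡ; zeroʳ; +-identityʳ; *-identityʳ; -‿inverseʳ)
open import Algebra.Properties.CommutativeMonoid.Sum +-commutativeMonoid using (sum; sum-cong-≗; sum-replicate-zero; sum-remove; ∑-distrib-+; ∑-comm)
open import Algebra.Properties.Semiring.Sum semiring using (*-distribˡ-sum; *-distribʳ-sum)
open import Algebra.Properties.Semiring.Exp semiring using (_^_; ^-homo-*)

sumFin≡sum : ∀ n f → sumFin n f ≡ sum f
sumFin≡sum zero    f = refl
sumFin≡sum (suc n) f = cong (f zero +ω_) (sumFin≡sum n (λ k → f (suc k)))

-- Determinants

sign-suc : ∀ k → sign (suc k) ≡ -ω sign k
sign-suc zero          = refl
sign-suc (suc zero)    = refl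
sign-suc (suc (suc k)) = sign-suc k

sign-+ : ∀ k l → sign (k ℕ.+ l) ≡ sign k *ω sign l
sign-+ zero    l = sym (*ω-identityˡ (sign l))
sign-+ (suc k) l = begin
  sign (suc (k ℕ.+ l))    ≡⟨ sign-suc (k ℕ.+ l) ⟩
  -ω sign (k ℕ.+ l)       ≡⟨ cong -ω_ (sign-+ k l) ⟩
  -ω (sign k *ω sign l)   ≡⟨ pull (sign k) (sign l) ⟩
  (-ω sign k) *ω sign l   ≡⟨ cong (_*ω sign l) (sign-suc k) ⟨
  sign (suc k) *ω sign l  ∎
  where
  open ≡-Reasoning
  pull : ∀ x y → -ω (x *ω y) ≡ (-ω x) *ω y
  pull = solve-∀ ℤω-ring

sign-double : ∀ k → sign (k ℕ.+ k) ≡ 1ω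
sign-double zero    = refl
sign-double (suc k) = trans (cong (λ n → sign (suc n)) (ℕP.+-suc k k)) (sign-double k)

δ : ∀ {n} → Fin n → Fin n → ℤω
δ zero    zero    = 1ω
δ zero    (suc j) = 0ω
δ (suc i) zero    = 0ω
δ (suc i) (suc j) = δ i j

δ-refl : ∀ {n} (i : Fin n) → δ i i ≡ 1ω
δ-refl zero    = refl
δ-refl (suc i) = δ-refl i

δ-≢ : ∀ {n} {i j : Fin n} → i ≢ j → δ i j ≡ 0ω
δ-≢ {i = zero}  {zero}  i≢j = contradiction refl i≢j
δ-≢ {i = zero}  {suc j} i≢j = refl
δ-≢ {i = suc i} {zero}  i≢j = refl
δ-≢ {i = suc i} {suc j} i≢j = δ-≢ (λ i≡j → i≢j (cong suc i≡j))

δ-punchIn : ∀ {n} (k : Fin (suc n)) i j → δ (punchIn k i) (punchIn k j) ≡ δ i j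
δ-punchIn zero    i       j       = refl
δ-punchIn (suc k) zero    zero    = refl
δ-punchIn (suc k) zero    (suc j) = refl
δ-punchIn (suc k) (suc i) zero    = refl
δ-punchIn (suc k) (suc i) (suc j) = δ-punchIn k i j

sum-δ : ∀ {n} (i : Fin n) (x : Fin n → ℤω) → sum (λ j → δ i j *ω x j) ≡ x i
sum-δ {suc n} zero x = begin
  1ω *ω x zero +ω sum (λ j → 0ω *ω x (suc j))  ≡⟨ cong₂ _+ω_ (*ω-identityˡ (x zero)) (sum-cong-≗ (λ j → zeroˡ (x (suc j)))) ⟩
  x zero +ω sum {n} (λ _ → 0ω)                 ≡⟨ cong (x zero +ω_) (sum-replicate-zero n) ⟩
  x zero +ω 0ω                                 ≡⟨ +-identityʳ (x zero) ⟩
  x zero                                       ∎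
  where open ≡-Reasoning
sum-δ {suc n} (suc i) x = begin
  0ω *ω x zero +ω sum (λ j → δ i j *ω x (suc j))  ≡⟨ cong₂ _+ω_ (zeroˡ (x zero)) (sum-δ i (λ j → x (suc j))) ⟩
  0ω +ω x (suc i)                                 ≡⟨ +ω-identityˡ (x (suc i)) ⟩
  x (suc i)                                       ∎
  where open ≡-Reasoning

colMinor : ∀ {k} (B : Fin k → Fin (suc k) → ℤω) → Fin (suc k) → ℤω
colMinor {k} B j = det k (λ r c → B r (punchIn j c))

expansionTerm : ∀ {n} → Matrix (suc n) → Fin (suc n) → ℤω
expansionTerm A j = sign (toℕ j) *ω A zero j *ω colMinor (λ r → A (suc r)) j

det-expand : ∀ {n} (A : Matrix (suc n)) → det (suc n) A ≡ sum (expansionTerm A)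
det-expand {n} A = sumFin≡sum (suc n) (expansionTerm A)

det-cong : ∀ n {A B : Matrix n} → (∀ r c → A r c ≡ B r c) → det n A ≡ det n B
det-cong zero    eq = refl
det-cong (suc n) {A} {B} eq = begin
  det (suc n) A          ≡⟨ det-expand A ⟩
  sum (expansionTerm A)  ≡⟨ sum-cong-≗ (λ j → cong₂ (λ x d → sign (toℕ j) *ω x *ω d) (eq zero j) (det-cong n (λ r c → eq (suc r) (punchIn j c)))) ⟩
  sum (expansionTerm B)  ≡⟨ det-expand B ⟨
  det (suc n) B          ∎
  where open ≡-Reasoning

-- crossing j p is the position that j occupies once punchIn j p has been removed.
crossing : ∀ {n} → Fin (suc n) → Fin n → Fin n
crossing zero    zero    = zero
crossing zero    (suc p) = zero
crossing (suc j) zero    = j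
crossing (suc j) (suc p) = suc (crossing j p)

punchIn-crossing : ∀ {n} (j : Fin (suc n)) p → punchIn (punchIn j p) (crossing j p) ≡ j
punchIn-crossing zero    zero    = refl
punchIn-crossing zero    (suc p) = refl
punchIn-crossing (suc j) zero    = refl
punchIn-crossing (suc j) (suc p) = cong suc (punchIn-crossing j p)

punchIn-exchange : ∀ {n} (j : Fin (suc (suc n))) p c → punchIn (punchIn j p) (punchIn (crossing j p) c) ≡ punchIn j (punchIn p c)
punchIn-exchange zero    zero    c       = refl
punchIn-exchange zero    (suc p) c       = refl
punchIn-exchange (suc j) zero    c       = refl
punchIn-exchange (suc j) (suc p) zero    = refl
punchIn-exchange (suc j) (suc p) (suc c) = cong suc (punchIn-exchange j p c)

-- Deleting the columns `j` and `punchIn j p` in the other order shifts exactly one of the two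
-- indices by one: `p` goes up if it lies at or beyond `j`, otherwise `j` goes down. Hence the
-- single extra sign.
sign-crossing : ∀ {n} (j : Fin (suc n)) p → sign (toℕ (punchIn j p)) *ω sign (toℕ (crossing j p)) ≡ sign (toℕ j) *ω sign (suc (toℕ p))
sign-crossing zero    zero    = refl
sign-crossing zero    (suc p) = *ω-comm (sign (toℕ p)) 1ω
sign-crossing (suc j) zero    = trans (neg (sign (toℕ j))) (cong (_*ω (-ω 1ω)) (sym (sign-suc (toℕ j))))
  where
  neg : ∀ x → 1ω *ω x ≡ (-ω x) *ω (-ω 1ω)
  neg = solve-∀ ℤω-ring
sign-crossing (suc j) (suc p) = begin
  sign (suc a) *ω sign (suc b)  ≡⟨ cong₂ _*ω_ (sign-suc a) (sign-suc b) ⟩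
  (-ω sign a) *ω (-ω sign b)    ≡⟨ neg-neg (sign a) (sign b) ⟩
  sign a *ω sign b              ≡⟨ sign-crossing j p ⟩
  sign c *ω sign d              ≡⟨ neg-neg (sign c) (sign d) ⟨
  (-ω sign c) *ω (-ω sign d)    ≡⟨ cong₂ _*ω_ (sign-suc c) (sign-suc d) ⟨
  sign (suc c) *ω sign (suc d)  ∎
  where
  open ≡-Reasoning
  a = toℕ (punchIn j p)
  b = toℕ (crossing j p)
  c = toℕ j
  d = suc (toℕ p)
  neg-neg : ∀ x y → (-ω x) *ω (-ω y) ≡ x *ω y
  neg-neg = solve-∀ ℤω-ring

colMerge : ∀ {k} → (Fin k → Fin (suc k) → ℤω) → Fin k → Matrix k
colMerge B j r c = B r (suc c) +ω δ j c *ω B r zero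

-- This is linearity in column `j`. The second part has column zero standing in place of column
-- `suc j`; moving it to the front past `j` columns turns it into the minor without `suc j` and
-- costs `sign (toℕ j)`. The induction expands all three determinants along their first rows.
det-colMerge : ∀ k (B : Fin k → Fin (suc k) → ℤω) j
  → det k (colMerge B j) ≡ colMinor B zero +ω sign (toℕ j) *ω colMinor B (suc j)
det-colMerge (suc k) B j = begin
  det (suc k) (colMerge B j)
    ≡⟨ det-expand (colMerge B j) ⟩
  sum t
    ≡⟨ sum-remove {i = j} t ⟩
  t j +ω sum (λ p → t (punchIn j p))
    ≡⟨ cong₂ _+ω_ head (trans (sum-cong-≗ tail) (∑-distrib-+ u w)) ⟩
  (s *ω b (suc j) *ω E +ω s *ω b zero *ω E) +ω (sum u +ω sum w)
    ≡⟨ rearrange (s *ω b (suc j) *ω E) (s *ω b zero *ω E) (sum u) (sum w) ⟩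
  (s *ω b (suc j) *ω E +ω sum u) +ω (s *ω b zero *ω E +ω sum w)
    ≡⟨ cong₂ _+ω_ first second ⟨
  colMinor B zero +ω s *ω colMinor B (suc j) ∎
  where
  open ≡-Reasoning
  s = sign (toℕ j)
  b = B zero
  B⁺ : Fin k → Fin (suc (suc k)) → ℤω
  B⁺ r = B (suc r)
  E = det k (λ r c → B⁺ r (suc (punchIn j c)))
  t : Fin (suc k) → ℤω
  t c = sign (toℕ c) *ω colMerge B j zero c *ω colMinor (λ r → colMerge B j (suc r)) c
  u w : Fin k → ℤω
  u p = sign (toℕ (punchIn j p)) *ω b (suc (punchIn j p)) *ω det k (λ r c → B⁺ r (suc (punchIn (punchIn j p) c)))
  w p = s *ω (sign (suc (toℕ p)) *ω b (suc (punchIn j p)) *ω det k (λ r c → B⁺ r (punchIn (suc j) (punchIn (suc p) c))))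

  rearrange : ∀ x y z v → (x +ω y) +ω (z +ω v) ≡ (x +ω z) +ω (y +ω v)
  rearrange = solve-∀ ℤω-ring

  δ-off : ∀ p → δ j (punchIn j p) ≡ 0ω
  δ-off p = δ-≢ (λ eq → punchInᵢ≢i j p (sym eq))

  drop-δ : ∀ r p → colMerge B j r (punchIn j p) ≡ B r (suc (punchIn j p))
  drop-δ r p = trans (cong (λ d → B r (suc (punchIn j p)) +ω d *ω B r zero) (δ-off p)) (absorb (B r (suc (punchIn j p))) (B r zero))
    where
    absorb : ∀ x y → x +ω 0ω *ω y ≡ x
    absorb = solve-∀ ℤω-ring

  head : t j ≡ s *ω b (suc j) *ω E +ω s *ω b zero *ω E
  head = trans (cong₂ (λ d e → s *ω (b (suc j) +ω d *ω b zero) *ω e) (δ-refl j) (det-cong k (λ r c → drop-δ (suc r) c)))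
               (split s (b (suc j)) (b zero) E)
    where
    split : ∀ s x y e → s *ω (x +ω 1ω *ω y) *ω e ≡ s *ω x *ω e +ω s *ω y *ω e
    split = solve-∀ ℤω-ring

  -- After column `punchIn j p` is deleted the merged column stands at `crossing j p`, where the
  -- induction hypothesis applies.
  tail : ∀ p → t (punchIn j p) ≡ u p +ω w p
  tail p = begin
    sq *ω colMerge B j zero q *ω colMinor (λ r → colMerge B j (suc r)) q
      ≡⟨ cong₂ (λ x e → sq *ω x *ω e) (drop-δ zero p) minor ⟩
    sq *ω b (suc q) *ω (F +ω sign (toℕ j′) *ω colMinor B′ (suc j′))
      ≡⟨ cong (λ e → sq *ω b (suc q) *ω (F +ω sign (toℕ j′) *ω e)) exchange ⟩
    sq *ω b (suc q) *ω (F +ω sign (toℕ j′) *ω H)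
      ≡⟨ expand sq (b (suc q)) F (sign (toℕ j′)) H ⟩
    u p +ω sq *ω sign (toℕ j′) *ω (b (suc q) *ω H)
      ≡⟨ cong (λ e → u p +ω e *ω (b (suc q) *ω H)) (sign-crossing j p) ⟩
    u p +ω s *ω sign (suc (toℕ p)) *ω (b (suc q) *ω H)
      ≡⟨ cong (u p +ω_) (reassoc s (sign (suc (toℕ p))) (b (suc q)) H) ⟩
    u p +ω w p ∎
    where
    q = punchIn j p
    sq = sign (toℕ q)
    j′ = crossing j p
    B′ : Fin k → Fin (suc k) → ℤω
    B′ r c = B⁺ r (punchIn (suc q) c)
    F = det k (λ r c → B⁺ r (suc (punchIn q c)))
    H = det k (λ r c → B⁺ r (punchIn (suc j) (punchIn (suc p) c)))
    expand : ∀ a x f σ h → a *ω x *ω (f +ω σ *ω h) ≡ a *ω x *ω f +ω a *ω σ *ω (x *ω h)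
    expand = solve-∀ ℤω-ring
    reassoc : ∀ a σ x h → a *ω σ *ω (x *ω h) ≡ a *ω (σ *ω x *ω h)
    reassoc = solve-∀ ℤω-ring
    minor : colMinor (λ r → colMerge B j (suc r)) q ≡ F +ω sign (toℕ j′) *ω colMinor B′ (suc j′)
    minor = trans
      (det-cong k (λ r c → cong (λ d → B⁺ r (suc (punchIn q c)) +ω d *ω B⁺ r zero)
        (trans (cong (λ i → δ i (punchIn q c)) (sym (punchIn-crossing j p))) (δ-punchIn q j′ c))))
      (det-colMerge k B′ j′)
    exchange : colMinor B′ (suc j′) ≡ H
    exchange = det-cong k (λ r c → cong (B⁺ r) (exch c))
      where
      exch : ∀ c → punchIn (suc q) (punchIn (suc j′) c) ≡ punchIn (suc j) (punchIn (suc p) c)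
      exch c = punchIn-exchange (suc j) (suc p) c

  first : colMinor B zero ≡ s *ω b (suc j) *ω E +ω sum u
  first = trans (det-expand B⁰) (sum-remove {i = j} (expansionTerm B⁰))
    where
    B⁰ : Matrix (suc k)
    B⁰ r c = B r (suc c)

  second : s *ω colMinor B (suc j) ≡ s *ω b zero *ω E +ω sum w
  second = begin
    s *ω colMinor B (suc j)
      ≡⟨ cong (s *ω_) (det-expand (λ r c → B r (punchIn (suc j) c))) ⟩
    s *ω (1ω *ω b zero *ω E +ω sum v)
      ≡⟨ *ω-distribˡ-+ω s (1ω *ω b zero *ω E) (sum v) ⟩
    s *ω (1ω *ω b zero *ω E) +ω s *ω sum v
      ≡⟨ cong₂ _+ω_ (unit s (b zero) E) (*-distribˡ-sum s v) ⟩
    s *ω b zero *ω E +ω sum w ∎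
    where
    v : Fin k → ℤω
    v p = sign (suc (toℕ p)) *ω b (suc (punchIn j p)) *ω det k (λ r c → B⁺ r (punchIn (suc j) (punchIn (suc p) c)))
    unit : ∀ s x e → s *ω (1ω *ω x *ω e) ≡ s *ω x *ω e
    unit = solve-∀ ℤω-ring

-- If `B` is what remains of a square matrix after deleting a row, these are the cofactors of that
-- row up to a sign independent of `j`.
signedMinor : ∀ {k} → (Fin k → Fin (suc k) → ℤω) → Fin (suc k) → ℤω
signedMinor B j = sign (toℕ j) *ω colMinor B j

-- The alternation between `j` and `suc j` absorbs the minus sign, so `det-colMerge` applies.
signedMinor-difference : ∀ {k} (B : Fin k → Fin (suc k) → ℤω) j
  → signedMinor B zero +ω -ω signedMinor B (suc j) ≡ det k (colMerge B j)
signedMinor-difference {k} B j = begin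
  1ω *ω X +ω -ω (sign (suc (toℕ j)) *ω Y)  ≡⟨ cong (λ σ → 1ω *ω X +ω -ω (σ *ω Y)) (sign-suc (toℕ j)) ⟩
  1ω *ω X +ω -ω ((-ω s) *ω Y)              ≡⟨ simplify X s Y ⟩
  X +ω s *ω Y                              ≡⟨ det-colMerge k B j ⟨
  det k (colMerge B j)                     ∎
  where
  open ≡-Reasoning
  s = sign (toℕ j)
  X = colMinor B zero
  Y = colMinor B (suc j)
  simplify : ∀ x s y → 1ω *ω x +ω -ω ((-ω s) *ω y) ≡ x +ω s *ω y
  simplify = solve-∀ ℤω-ring

det-expand-signedMinor : ∀ {n} (A : Matrix (suc n)) → det (suc n) A ≡ sum (λ j → A zero j *ω signedMinor (λ r → A (suc r)) j)
det-expand-signedMinor A = trans (det-expand A) (sum-cong-≗ (λ j → swap (sign (toℕ j)) (A zero j) (colMinor (λ r → A (suc r)) j)))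
  where
  swap : ∀ s a d → s *ω a *ω d ≡ a *ω (s *ω d)
  swap = solve-∀ ℤω-ring

-- Mutual induction with `det-zeroRowSums`. Adding one column to another preserves row sums, so the
-- difference of two signed minors is a determinant with zero row sums. Such a determinant vanishes
-- because, its cofactors along the first row being equal, it is that cofactor times a row sum.
signedMinor-constant : ∀ k (B : Fin k → Fin (suc k) → ℤω) → (∀ r → sum (B r) ≡ 0ω) → ∀ j → signedMinor B j ≡ signedMinor B zero
det-zeroRowSums : ∀ k (A : Matrix (suc k)) → (∀ r → sum (A r) ≡ 0ω) → det (suc k) A ≡ 0ω

signedMinor-constant k       B rows zero    = refl
signedMinor-constant (suc k) B rows (suc j) = equal (signedMinor B zero) (signedMinor B (suc j))
    (trans (signedMinor-difference B j) (det-zeroRowSums k (colMerge B j) mergedRows))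
  where
  open ≡-Reasoning
  equal : ∀ x y → x +ω -ω y ≡ 0ω → y ≡ x
  equal x y x-y≡0 = trans (sym (+ω-identityˡ y)) (trans (cong (_+ω y) (sym x-y≡0)) (cancel x y))
    where
    cancel : ∀ x y → x +ω -ω y +ω y ≡ x
    cancel = solve-∀ ℤω-ring
  mergedRows : ∀ r → sum (colMerge B j r) ≡ 0ω
  mergedRows r = begin
    sum (colMerge B j r)                                             ≡⟨ ∑-distrib-+ (λ c → B r (suc c)) (λ c → δ j c *ω B r zero) ⟩
    sum (λ c → B r (suc c)) +ω sum (λ c → δ j c *ω B r zero)         ≡⟨ cong (sum (λ c → B r (suc c)) +ω_) (sum-δ j (λ _ → B r zero)) ⟩
    sum (λ c → B r (suc c)) +ω B r zero                              ≡⟨ +ω-comm (sum (λ c → B r (suc c))) (B r zero) ⟩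
    sum (B r)                                                        ≡⟨ rows r ⟩
    0ω                                                               ∎

det-zeroRowSums k A rows = begin
  det (suc k) A                                ≡⟨ det-expand-signedMinor A ⟩
  sum (λ j → A zero j *ω signedMinor A⁺ j)     ≡⟨ sum-cong-≗ (λ j → cong (A zero j *ω_) (signedMinor-constant k A⁺ (λ r → rows (suc r)) j)) ⟩
  sum (λ j → A zero j *ω signedMinor A⁺ zero)  ≡⟨ *-distribʳ-sum (signedMinor A⁺ zero) (A zero) ⟨
  sum (A zero) *ω signedMinor A⁺ zero          ≡⟨ cong (_*ω signedMinor A⁺ zero) (rows zero) ⟩
  0ω *ω signedMinor A⁺ zero                    ≡⟨ zeroˡ (signedMinor A⁺ zero) ⟩
  0ω                                           ∎
  where
  open ≡-Reasoning
  A⁺ : Fin k → Fin (suc k) → ℤω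
  A⁺ r = A (suc r)

prod : ∀ {n} → (Fin n → ℤω) → ℤω
prod {zero}  x = 1ω
prod {suc n} x = x zero *ω prod (λ i → x (suc i))

prod-punchIn : ∀ {n} (x : Fin (suc n) → ℤω) j → x j *ω prod (λ i → x (punchIn j i)) ≡ prod x
prod-punchIn x zero = refl
prod-punchIn {suc n} x (suc j) = trans
  (swap (x (suc j)) (x zero) (prod (λ i → x (suc (punchIn j i)))))
  (cong (x zero *ω_) (prod-punchIn (λ i → x (suc i)) j))
  where
  swap : ∀ a b c → a *ω (b *ω c) ≡ b *ω (a *ω c)
  swap = solve-∀ ℤω-ring

det-scale : ∀ n (x y : Fin n → ℤω) (A : Matrix n)
  → det n (λ r c → x r *ω A r c *ω y c) ≡ (prod x *ω prod y) *ω det n A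
det-scale zero    x y A = refl
det-scale (suc n) x y A = begin
  det (suc n) (λ r c → x r *ω A r c *ω y c)                     ≡⟨ det-expand (λ r c → x r *ω A r c *ω y c) ⟩
  sum (expansionTerm (λ r c → x r *ω A r c *ω y c))             ≡⟨ sum-cong-≗ term ⟩
  sum (λ j → (prod x *ω prod y) *ω expansionTerm A j)           ≡⟨ *-distribˡ-sum (prod x *ω prod y) (expansionTerm A) ⟨
  (prod x *ω prod y) *ω sum (expansionTerm A)                   ≡⟨ cong ((prod x *ω prod y) *ω_) (det-expand A) ⟨
  (prod x *ω prod y) *ω det (suc n) A                           ∎
  where
  open ≡-Reasoning
  x⁺ : Fin n → ℤω
  x⁺ i = x (suc i)
  regroup : ∀ s x₀ a y₀ p q d → s *ω (x₀ *ω a *ω y₀) *ω ((p *ω q) *ω d) ≡ ((x₀ *ω p) *ω (y₀ *ω q)) *ω (s *ω a *ω d)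
  regroup = solve-∀ ℤω-ring
  term : ∀ j → expansionTerm (λ r c → x r *ω A r c *ω y c) j ≡ (prod x *ω prod y) *ω expansionTerm A j
  term j = begin
    sign (toℕ j) *ω (x zero *ω A zero j *ω y j) *ω colMinor (λ r c → x (suc r) *ω A (suc r) c *ω y c) j
      ≡⟨ cong (sign (toℕ j) *ω (x zero *ω A zero j *ω y j) *ω_) (det-scale n x⁺ (λ c → y (punchIn j c)) (λ r c → A (suc r) (punchIn j c))) ⟩
    sign (toℕ j) *ω (x zero *ω A zero j *ω y j) *ω ((prod x⁺ *ω prod (λ c → y (punchIn j c))) *ω colMinor (λ r → A (suc r)) j)
      ≡⟨ regroup (sign (toℕ j)) (x zero) (A zero j) (y j) (prod x⁺) (prod (λ c → y (punchIn j c))) (colMinor (λ r → A (suc r)) j) ⟩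
    (prod x *ω (y j *ω prod (λ c → y (punchIn j c)))) *ω expansionTerm A j
      ≡⟨ cong (λ q → (prod x *ω q) *ω expansionTerm A j) (prod-punchIn y j) ⟩
    (prod x *ω prod y) *ω expansionTerm A j ∎

-- Contraction and parent functions

⟦_⟧ : Bool → ℤω
⟦ true ⟧  = 1ω
⟦ false ⟧ = 0ω

⟦∧⟧ : ∀ a b → ⟦ a ∧ b ⟧ ≡ ⟦ a ⟧ *ω ⟦ b ⟧
⟦∧⟧ true  b = sym (*ω-identityˡ ⟦ b ⟧)
⟦∧⟧ false b = sym (zeroˡ ⟦ b ⟧)

δᴹ : ∀ {k} → Maybe (Fin k) → Fin k → ℤω
δᴹ nothing  j = 0ω
δᴹ (just i) j = δ i j

-- The Laplacian of a digraph some of whose vertices have been merged: the rows and columns are the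
-- vertices still to be given a parent, A i v says that i may point to v, and rep v is the vertex
-- into which v has been merged (nothing for the root).
mergedLaplacian : ∀ {k N} → (Fin k → Fin N → Bool) → (Fin N → Maybe (Fin k)) → Matrix k
mergedLaplacian A rep i j = sum (λ v → ⟦ A i v ⟧ *ω (δ i j +ω -ω δᴹ (rep v) j))

-- Fails exactly when the target already belongs to the class of vertex zero, so that pointing there
-- would close a cycle.
avoidsZero : ∀ {k} → Maybe (Fin (suc k)) → Bool
avoidsZero nothing        = true
avoidsZero (just zero)    = false
avoidsZero (just (suc j)) = true

predᴹ : ∀ {k} → Maybe (Fin (suc k)) → Maybe (Fin k)
predᴹ nothing        = nothing
predᴹ (just zero)    = nothing
predᴹ (just (suc j)) = just j

-- contract t merges vertex zero into t; the value at t ≡ just zero is junk.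
contract : ∀ {k} → Maybe (Fin (suc k)) → Maybe (Fin (suc k)) → Maybe (Fin k)
contract t nothing        = nothing
contract t (just zero)    = predᴹ t
contract t (just (suc j)) = just j

-- The entry recorded is the vertex `v` itself and not its class, so that different edges into one
-- class give different vectors. Merging zero into the class of `v` makes later choices see the
-- paths through zero.
parentVectors : ∀ k {N} → (Fin k → Fin N → Bool) → (Fin N → Maybe (Fin k)) → List (Vec (Fin N) k)
branch        : ∀ {k N} → (Fin (suc k) → Fin N → Bool) → (Fin N → Maybe (Fin (suc k))) → Fin N → List (Vec (Fin N) (suc k))

parentVectors zero    A rep = [] ∷ []
parentVectors (suc k) A rep = concat (tabulate (branch A rep))

branch {k} A rep v = if A zero v ∧ avoidsZero (rep v)
  then map (v ∷_) (parentVectors k (λ i → A (suc i)) (λ u → contract (rep v) (rep u)))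
  else []

contract-nothing : ∀ {k} x (c : Fin k) → δᴹ (contract nothing x) c ≡ δᴹ x (suc c)
contract-nothing nothing        c = refl
contract-nothing (just zero)    c = refl
contract-nothing (just (suc i)) c = refl

contract-just : ∀ {k} j x (c : Fin k) → δᴹ (contract (just (suc j)) x) c ≡ δᴹ x (suc c) +ω δ j c *ω δᴹ x zero
contract-just j nothing        c = sym (trans (+ω-identityˡ _) (zeroʳ (δ j c)))
contract-just j (just zero)    c = sym (trans (+ω-identityˡ _) (*-identityʳ (δ j c)))
contract-just j (just (suc i)) c = sym (trans (cong (δ i c +ω_) (zeroʳ (δ j c))) (+-identityʳ (δ i c)))

module _ {k N} (A : Fin (suc k) → Fin N → Bool) (rep : Fin N → Maybe (Fin (suc k))) where
  open ≡-Reasoning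

  private
    L  = mergedLaplacian A rep
    A⁺ : Fin k → Fin N → Bool
    A⁺ i = A (suc i)
    L⁺ : Fin k → Fin (suc k) → ℤω
    L⁺ r = L (suc r)
    S  = signedMinor L⁺

    Sᴹ : Maybe (Fin (suc k)) → ℤω
    Sᴹ t = sum (λ j → δᴹ t j *ω S j)

  contracted : Maybe (Fin (suc k)) → Matrix k
  contracted t = mergedLaplacian A⁺ (λ u → contract t (rep u))

  contracted-root : ∀ r c → L (suc r) (suc c) ≡ contracted nothing r c
  contracted-root r c = sum-cong-≗ (λ v → cong (λ x → ⟦ A (suc r) v ⟧ *ω (δ r c +ω -ω x)) (sym (contract-nothing (rep v) c)))

  -- Arrows that ended in zero now end in `suc j`, which is the effect of adding column zero to that
  -- column. The diagonal part is undisturbed, since row `suc r` has none in column zero.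
  contracted-vertex : ∀ j r c → colMerge L⁺ j r c ≡ contracted (just (suc j)) r c
  contracted-vertex j r c = begin
    L (suc r) (suc c) +ω δ j c *ω L (suc r) zero
      ≡⟨ cong (L (suc r) (suc c) +ω_) (*-distribˡ-sum (δ j c) (λ v → ⟦ A (suc r) v ⟧ *ω (0ω +ω -ω δᴹ (rep v) zero))) ⟩
    L (suc r) (suc c) +ω sum (λ v → δ j c *ω (⟦ A (suc r) v ⟧ *ω (0ω +ω -ω δᴹ (rep v) zero)))
      ≡⟨ ∑-distrib-+ (λ v → ⟦ A (suc r) v ⟧ *ω (δ r c +ω -ω δᴹ (rep v) (suc c))) (λ v → δ j c *ω (⟦ A (suc r) v ⟧ *ω (0ω +ω -ω δᴹ (rep v) zero))) ⟨
    sum (λ v → ⟦ A (suc r) v ⟧ *ω (δ r c +ω -ω δᴹ (rep v) (suc c)) +ω δ j c *ω (⟦ A (suc r) v ⟧ *ω (0ω +ω -ω δᴹ (rep v) zero)))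
      ≡⟨ sum-cong-≗ (λ v → trans (collect ⟦ A (suc r) v ⟧ (δ r c) (δᴹ (rep v) (suc c)) (δ j c) (δᴹ (rep v) zero))
                                 (cong (λ x → ⟦ A (suc r) v ⟧ *ω (δ r c +ω -ω x)) (sym (contract-just j (rep v) c)))) ⟩
    contracted (just (suc j)) r c ∎
    where
    collect : ∀ a d x e y → a *ω (d +ω -ω x) +ω e *ω (a *ω (0ω +ω -ω y)) ≡ a *ω (d +ω -ω (x +ω e *ω y))
    collect = solve-∀ ℤω-ring

  -- The left side is the expansion of the determinant whose row zero has been replaced by e_zero -
  -- e_t, where the root has no column. For the root this leaves one minor; for t zero the row
  -- vanishes; otherwise a difference of minors merges zero into t.
  contraction-step : ∀ t → S zero +ω -ω Sᴹ t ≡ ⟦ avoidsZero t ⟧ *ω det k (contracted t)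
  contraction-step nothing = begin
    S zero +ω -ω Sᴹ nothing            ≡⟨ cong (λ x → S zero +ω -ω x) (trans (sum-cong-≗ (λ j → zeroˡ (S j))) (sum-replicate-zero (suc k))) ⟩
    S zero +ω 0ω                       ≡⟨ +-identityʳ (S zero) ⟩
    1ω *ω colMinor L⁺ zero             ≡⟨ cong (1ω *ω_) (det-cong k contracted-root) ⟩
    1ω *ω det k (contracted nothing)   ∎
  contraction-step (just zero) = begin
    S zero +ω -ω Sᴹ (just zero)           ≡⟨ cong (λ x → S zero +ω -ω x) (sum-δ zero S) ⟩
    S zero +ω -ω S zero                   ≡⟨ -‿inverseʳ (S zero) ⟩
    0ω                                    ≡⟨ zeroˡ (det k (contracted (just zero))) ⟨
    0ω *ω det k (contracted (just zero))  ∎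
  contraction-step (just (suc j)) = begin
    S zero +ω -ω Sᴹ (just (suc j))            ≡⟨ cong (λ x → S zero +ω -ω x) (sum-δ (suc j) S) ⟩
    S zero +ω -ω S (suc j)                    ≡⟨ signedMinor-difference L⁺ j ⟩
    det k (colMerge L⁺ j)                     ≡⟨ det-cong k (contracted-vertex j) ⟩
    det k (contracted (just (suc j)))         ≡⟨ *ω-identityˡ (det k (contracted (just (suc j)))) ⟨
    1ω *ω det k (contracted (just (suc j)))   ∎

  det-contraction : det (suc k) L ≡ sum (λ v → ⟦ A zero v ∧ avoidsZero (rep v) ⟧ *ω det k (contracted (rep v)))
  det-contraction = begin
    det (suc k) L
      ≡⟨ det-expand-signedMinor L ⟩
    sum (λ j → L zero j *ω S j)
      ≡⟨ sum-cong-≗ (λ j → *-distribʳ-sum (S j) (λ v → a v *ω (δ zero j +ω -ω δᴹ (rep v) j))) ⟩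
    sum (λ j → sum (λ v → a v *ω (δ zero j +ω -ω δᴹ (rep v) j) *ω S j))
      ≡⟨ ∑-comm (λ j v → a v *ω (δ zero j +ω -ω δᴹ (rep v) j) *ω S j) ⟩
    sum (λ v → sum (λ j → a v *ω (δ zero j +ω -ω δᴹ (rep v) j) *ω S j))
      ≡⟨ sum-cong-≗ (λ v → inner v (rep v)) ⟩
    sum (λ v → ⟦ A zero v ∧ avoidsZero (rep v) ⟧ *ω det k (contracted (rep v))) ∎
    where
    a : Fin N → ℤω
    a v = ⟦ A zero v ⟧
    split : ∀ a x y s → a *ω (x +ω -ω y) *ω s ≡ a *ω (x *ω s) +ω (-ω a) *ω (y *ω s)
    split = solve-∀ ℤω-ring
    factor : ∀ a x y → a *ω x +ω (-ω a) *ω y ≡ a *ω (x +ω -ω y)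
    factor = solve-∀ ℤω-ring
    inner : ∀ v t → sum (λ j → a v *ω (δ zero j +ω -ω δᴹ t j) *ω S j) ≡ ⟦ A zero v ∧ avoidsZero t ⟧ *ω det k (contracted t)
    inner v t = begin
      sum (λ j → a v *ω (δ zero j +ω -ω δᴹ t j) *ω S j)
        ≡⟨ sum-cong-≗ (λ j → split (a v) (δ zero j) (δᴹ t j) (S j)) ⟩
      sum (λ j → a v *ω (δ zero j *ω S j) +ω (-ω a v) *ω (δᴹ t j *ω S j))
        ≡⟨ ∑-distrib-+ (λ j → a v *ω (δ zero j *ω S j)) (λ j → (-ω a v) *ω (δᴹ t j *ω S j)) ⟩
      sum (λ j → a v *ω (δ zero j *ω S j)) +ω sum (λ j → (-ω a v) *ω (δᴹ t j *ω S j))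
        ≡⟨ cong₂ _+ω_ (*-distribˡ-sum (a v) (λ j → δ zero j *ω S j)) (*-distribˡ-sum (-ω a v) (λ j → δᴹ t j *ω S j)) ⟨
      a v *ω sum (λ j → δ zero j *ω S j) +ω (-ω a v) *ω Sᴹ t
        ≡⟨ cong (λ x → a v *ω x +ω (-ω a v) *ω Sᴹ t) (sum-δ zero S) ⟩
      a v *ω S zero +ω (-ω a v) *ω Sᴹ t
        ≡⟨ factor (a v) (S zero) (Sᴹ t) ⟩
      a v *ω (S zero +ω -ω Sᴹ t)
        ≡⟨ cong (a v *ω_) (contraction-step t) ⟩
      a v *ω (⟦ avoidsZero t ⟧ *ω det k (contracted t))
        ≡⟨ *ω-assoc (a v) ⟦ avoidsZero t ⟧ (det k (contracted t)) ⟨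
      (a v *ω ⟦ avoidsZero t ⟧) *ω det k (contracted t)
        ≡⟨ cong (_*ω det k (contracted t)) (⟦∧⟧ (A zero v) (avoidsZero t)) ⟨
      ⟦ A zero v ∧ avoidsZero t ⟧ *ω det k (contracted t) ∎

length-concat-tabulate : ∀ {X : Set} N (F : Fin N → List X)
  → fromℕω (length (concat (tabulate F))) ≡ sum (λ v → fromℕω (length (F v)))
length-concat-tabulate zero    F = refl
length-concat-tabulate (suc N) F = trans
  (cong fromℕω (length-++ (F zero)))
  (cong (fromℕω (length (F zero)) +ω_) (length-concat-tabulate N (λ v → F (suc v))))

-- `parentVectors` branches just as `det-contraction` sums, and the empty determinant 1 matches the
-- one empty vector.
det-mergedLaplacian : ∀ k {N} (A : Fin k → Fin N → Bool) (rep : Fin N → Maybe (Fin k))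
  → det k (mergedLaplacian A rep) ≡ fromℕω (length (parentVectors k A rep))
det-mergedLaplacian zero    A rep = refl
det-mergedLaplacian (suc k) {N} A rep = begin
  det (suc k) (mergedLaplacian A rep)
    ≡⟨ det-contraction A rep ⟩
  sum (λ v → ⟦ A zero v ∧ avoidsZero (rep v) ⟧ *ω det k (contracted A rep (rep v)))
    ≡⟨ sum-cong-≗ (λ v → trans
         (cong (⟦ A zero v ∧ avoidsZero (rep v) ⟧ *ω_) (det-mergedLaplacian k (λ i → A (suc i)) (λ u → contract (rep v) (rep u))))
         (length-branch v (A zero v ∧ avoidsZero (rep v)) (parentVectors k (λ i → A (suc i)) (λ u → contract (rep v) (rep u))))) ⟩
  sum (λ v → fromℕω (length (branch A rep v)))
    ≡⟨ length-concat-tabulate N (branch A rep) ⟨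
  fromℕω (length (parentVectors (suc k) A rep)) ∎
  where
  open ≡-Reasoning
  length-branch : ∀ v b fs → ⟦ b ⟧ *ω fromℕω (length fs) ≡ fromℕω (length (if b then map (v ∷_) fs else []))
  length-branch v true  fs = trans (*ω-identityˡ _) (cong fromℕω (sym (length-map (v ∷_) fs)))
  length-branch v false fs = zeroˡ (fromℕω (length fs))

-- On a finite set such ranks exist exactly when iterating `g` never cycles; `nothing` is an exit to
-- the root.
Ranked : ∀ {k} → (Fin k → Maybe (Fin k)) → Set
Ranked {k} g = ∃ λ (d : Fin k → ℕ) → ∀ {i j} → g i ≡ just j → d j < d i

contract≡just : ∀ {k} t x {j : Fin k} → contract t x ≡ just j → x ≡ just (suc j) ⊎ (x ≡ just zero × t ≡ just (suc j))
contract≡just t (just (suc i)) refl = inj₁ refl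
contract≡just (just (suc i)) (just zero) refl = inj₂ (refl , refl)

-- An arrow created by contraction is two old arrows through zero, hence two descents.
ranked-contract⁺ : ∀ {k} (g : Fin (suc k) → Maybe (Fin (suc k)))
  → Ranked g → avoidsZero (g zero) ≡ true × Ranked (λ i → contract (g zero) (g (suc i)))
ranked-contract⁺ g (d , dec) = avoids (g zero) refl , (λ i → d (suc i)) , dec′
  where
  avoids : ∀ t → g zero ≡ t → avoidsZero t ≡ true
  avoids nothing        eq = refl
  avoids (just zero)    eq = contradiction (dec eq) (ℕP.<-irrefl refl)
  avoids (just (suc j)) eq = refl
  dec′ : ∀ {i j} → contract (g zero) (g (suc i)) ≡ just j → d (suc j) < d (suc i)
  dec′ {i} eq with contract≡just (g zero) (g (suc i)) eq
  ... | inj₁ e        = dec e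
  ... | inj₂ (e , e₀) = ℕP.<-trans (dec e₀) (dec e)

-- Vertex zero is ranked just above its target; doubling the old ranks makes room for it.
ranked-contract⁻ : ∀ {k} (g : Fin (suc k) → Maybe (Fin (suc k)))
  → avoidsZero (g zero) ≡ true → Ranked (λ i → contract (g zero) (g (suc i))) → Ranked g
ranked-contract⁻ {k} g ok (d , dec) = rank (g zero) refl
  where
  rank : ∀ t → g zero ≡ t → Ranked g
  rank (just zero) eq = contradiction (trans (sym ok) (cong avoidsZero eq)) λ ()
  rank nothing     eq = d′ , dec′
    where
    d′ : Fin (suc k) → ℕ
    d′ zero    = 0
    d′ (suc i) = suc (d i)
    dec′ : ∀ {i j} → g i ≡ just j → d′ j < d′ i
    dec′ {zero}          e = contradiction (trans (sym e) eq) λ ()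
    dec′ {suc i} {zero}  e = s≤s z≤n
    dec′ {suc i} {suc j} e = s≤s (dec (cong (contract (g zero)) e))
  rank (just (suc t)) eq = d′ , dec′
    where
    d′ : Fin (suc k) → ℕ
    d′ zero    = suc (d t ℕ.* 2)
    d′ (suc i) = d i ℕ.* 2
    dec′ : ∀ {i j} → g i ≡ just j → d′ j < d′ i
    dec′ {zero}  {j}     e with refl ← just-injective (trans (sym e) eq) = ℕP.≤-refl
    -- `suc (d t) ℕ.* 2` computes to `suc (d′ zero)`, so doubling the weak form of `d t < d i`
    -- already gives the strict inequality.
    dec′ {suc i} {zero}  e = ℕP.*-monoˡ-≤ 2 (dec (trans (cong (contract (g zero)) e) (cong predᴹ eq)))
    dec′ {suc i} {suc j} e = ℕP.*-monoˡ-< 2 (dec (cong (contract (g zero)) e))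

∈-if⁻ : ∀ {X : Set} {x : X} b {xs} → x ∈ (if b then xs else []) → b ≡ true × x ∈ xs
∈-if⁻ true x∈ = refl , x∈

∈-if⁺ : ∀ {X : Set} {x : X} {b xs} → b ≡ true → x ∈ xs → x ∈ (if b then xs else [])
∈-if⁺ refl x∈ = x∈

∧-true⁻ : ∀ {a b} → a ∧ b ≡ true → a ≡ true × b ≡ true
∧-true⁻ {true} {true} refl = refl , refl

∈-parentVectors⁻ : ∀ k {N} (A : Fin k → Fin N → Bool) rep {f} → f ∈ parentVectors k A rep
  → (∀ i → A i (lookup f i) ≡ true) × Ranked (λ i → rep (lookup f i))
∈-parentVectors⁻ zero    A rep f∈ = (λ ()) , (λ ()) , λ { {()} }
∈-parentVectors⁻ (suc k) A rep f∈
  with fs , f∈fs , fs∈ ← ∈-concat⁻′ _ f∈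
  with v , refl ← ∈-tabulate⁻ {f = branch A rep} fs∈
  with ok , f∈map ← ∈-if⁻ (A zero v ∧ avoidsZero (rep v)) f∈fs
  with g , g∈ , refl ← ∈-map⁻ (v ∷_) f∈map
  with edge , avoids ← ∧-true⁻ ok
  with edges , ranked ← ∈-parentVectors⁻ k (λ i → A (suc i)) (λ u → contract (rep v) (rep u)) g∈
  = (λ { zero → edge ; (suc i) → edges i }) , ranked-contract⁻ (λ i → rep (lookup (v ∷ g) i)) avoids ranked

∈-parentVectors⁺ : ∀ k {N} (A : Fin k → Fin N → Bool) rep f
  → (∀ i → A i (lookup f i) ≡ true) → Ranked (λ i → rep (lookup f i)) → f ∈ parentVectors k A rep
∈-parentVectors⁺ zero    A rep []      edges ranked = here refl
∈-parentVectors⁺ (suc k) A rep (v ∷ f) edges ranked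
  with avoids , ranked′ ← ranked-contract⁺ (λ i → rep (lookup (v ∷ f) i)) ranked
  = ∈-concat⁺′ (∈-if⁺ (cong₂ _∧_ (edges zero) avoids)
                      (∈-map⁺ (v ∷_) (∈-parentVectors⁺ k (λ i → A (suc i)) (λ u → contract (rep v) (rep u)) f (λ i → edges (suc i)) ranked′)))
               (∈-tabulate⁺ {f = branch A rep} v)

parentVectors-unique : ∀ k {N} (A : Fin k → Fin N → Bool) rep → Unique (parentVectors k A rep)
parentVectors-unique zero    A rep = All.[] ∷ []
parentVectors-unique (suc k) A rep = Unique.concat⁺
  (All.tabulate⁺ (λ v → unique-if (A zero v ∧ avoidsZero (rep v)) (Unique.map⁺ Vec.∷-injectiveʳ (parentVectors-unique k _ _))))
  (AllPairs.tabulate⁺ disjoint)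
  where
  unique-if : ∀ {X : Set} b {xs : List X} → Unique xs → Unique (if b then xs else [])
  unique-if true  u = u
  unique-if false u = []
  head-branch : ∀ {v} b {fs f} → f ∈ (if b then map (v ∷_) fs else []) → lookup f zero ≡ v
  head-branch {v} true f∈ with g , g∈ , refl ← ∈-map⁻ (v ∷_) f∈ = refl
  disjoint : ∀ {v w} → v ≢ w → Disjoint (branch A rep v) (branch A rep w)
  disjoint {v} {w} v≢w (f∈v , f∈w) = v≢w (trans (sym (head-branch (A zero v ∧ avoidsZero (rep v)) f∈v)) (head-branch (A zero w ∧ avoidsZero (rep w)) f∈w))

-- Walks and spanning trees

pairs : ∀ {A : Set} → List A → List (A × A)
pairs []          = []
pairs (x ∷ [])    = []
pairs (x ∷ y ∷ r) = (x , y) ∷ pairs (y ∷ r)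

-- The local function of closedPairs has no name: abstracting x ∷ xs turns the goal into its
-- recursive form, from which the omitted left-hand side of the auxiliary lemma is inferred.
mutual
  closedPairs-∷ : ∀ {n} (x : Fin n) xs (f : List (Fin n) → List (Fin n × Fin n))
    → (∀ ys → f ys ≡ pairs (ys ++ x ∷ [])) → closedPairs (x ∷ xs) ≡ f (x ∷ xs)
  closedPairs-∷ x xs f f≡ with x ∷ xs
  ... | ys = trans (closing x xs ys) (sym (f≡ ys))

  closing : ∀ {n} (x : Fin n) (xs ys : List (Fin n)) → _ ≡ pairs (ys ++ x ∷ [])
  closing x xs []          = refl
  closing x xs (y ∷ [])    = refl
  closing x xs (y ∷ z ∷ r) = cong ((y , z) ∷_) (closing x xs (z ∷ r))

closedPairs≡pairs : ∀ {n} (x : Fin n) xs → closedPairs (x ∷ xs) ≡ pairs (x ∷ xs ++ x ∷ [])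
closedPairs≡pairs x xs = closedPairs-∷ x xs (λ ys → pairs (ys ++ x ∷ [])) (λ _ → refl)

module Walks {n} {R : Fin n → Fin n → Set} where

  infixr 5 _++ʷ_

  _++ʷ_ : ∀ {i j k} → Reach R i j → Reach R j k → Reach R i k
  here     ++ʷ w₂ = w₂
  step e w ++ʷ w₂ = step e (w ++ʷ w₂)

  len : ∀ {i j} → Reach R i j → ℕ
  len here       = 0
  len (step e w) = suc (len w)

  -- The endpoint is left out, so a closed walk yields its vertices in the form that `IsCycle`
  -- expects.
  starts : ∀ {i j} → Reach R i j → List (Fin n)
  starts here           = []
  starts (step {i} e w) = i ∷ starts w

  path : ∀ {i j} → Reach R i j → List (Fin n)
  path {j = j} w = starts w ++ j ∷ []

  starts-++ : ∀ {i j k} (w₁ : Reach R i j) (w₂ : Reach R j k) → starts (w₁ ++ʷ w₂) ≡ starts w₁ ++ starts w₂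
  starts-++ here        w₂ = refl
  starts-++ (step e w₁) w₂ = cong (_ ∷_) (starts-++ w₁ w₂)

  path-++ : ∀ {i j k} (w₁ : Reach R i j) (w₂ : Reach R j k) → path (w₁ ++ʷ w₂) ≡ starts w₁ ++ path w₂
  path-++ here        w₂ = refl
  path-++ (step e w₁) w₂ = cong (_ ∷_) (path-++ w₁ w₂)

  len-++ : ∀ {i j k} (w₁ : Reach R i j) (w₂ : Reach R j k) → len (w₁ ++ʷ w₂) ≡ len w₁ ℕ.+ len w₂
  len-++ here        w₂ = refl
  len-++ (step e w₁) w₂ = cong suc (len-++ w₁ w₂)

  end∈path : ∀ {i j} (w : Reach R i j) → j ∈ path w
  end∈path w = ∈-++⁺ʳ (starts w) (here refl)

  pairs-path : ∀ {i j} (w : Reach R i j) → All (uncurry R) (pairs (path w))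
  pairs-path here                = []
  pairs-path (step e here)       = e ∷ []
  pairs-path (step e (step e′ w)) = e ∷ pairs-path (step e′ w)

  -- The split is at the first visit to `x`; that the prefix avoids `x` is what makes the loops cut
  -- out in `findLoop` simple.
  splitAt : ∀ x {i k} (w : Reach R i k)
    → x ∉ path w ⊎ (∃₂ λ (w₁ : Reach R i x) (w₂ : Reach R x k) → w ≡ w₁ ++ʷ w₂ × x ∉ starts w₁)
  splitAt x {i} here with x ≟ i
  ... | yes refl = inj₂ (here , here , refl , λ ())
  ... | no x≢i   = inj₁ λ { (here x≡i) → x≢i x≡i }
  splitAt x (step {i} e w) with x ≟ i
  ... | yes refl = inj₂ (here , step e w , refl , λ ())
  ... | no x≢i with splitAt x w
  ...   | inj₁ x∉ = inj₁ λ { (here x≡i) → x≢i x≡i ; (there x∈) → x∉ x∈ }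
  ...   | inj₂ (w₁ , w₂ , refl , x∉) = inj₂ (step e w₁ , w₂ , refl , λ { (here x≡i) → x≢i x≡i ; (there x∈) → x∉ x∈ })

  unique-++ˡ : ∀ {xs ys : List (Fin n)} → Unique (xs ++ ys) → Unique xs
  unique-++ˡ {[]}     u       = []
  unique-++ˡ {x ∷ xs} (p ∷ u) = All.++⁻ˡ xs p ∷ unique-++ˡ u

  unique-++ʳ : ∀ xs {ys : List (Fin n)} → Unique (xs ++ ys) → Unique ys
  unique-++ʳ []       u       = u
  unique-++ʳ (x ∷ xs) (_ ∷ u) = unique-++ʳ xs u

  -- The walk is searched from its end: when a vertex is the first to recur in a tail with distinct
  -- vertices, the stretch up to its recurrence is a simple loop. Loops of two steps are allowed,
  -- although they are no cycles.
  findLoop : ∀ {i k} (w : Reach R i k)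
    → Unique (path w)
    ⊎ (∃₂ λ y z → ∃₂ λ (pre : Reach R i y) (e : R y z) → ∃₂ λ (loop : Reach R z y) (post : Reach R y k)
        → w ≡ pre ++ʷ step e loop ++ʷ post × Unique (y ∷ starts loop))
  findLoop here = inj₁ ([] ∷ [])
  findLoop (step {i} {j} e w) with findLoop w
  ... | inj₂ (y , z , pre , e′ , loop , post , refl , u) = inj₂ (y , z , step e pre , e′ , loop , post , refl , u)
  ... | inj₁ u with splitAt i w
  ...   | inj₁ i∉ = inj₁ (All.¬Any⇒All¬ _ i∉ ∷ u)
  ...   | inj₂ (w₁ , w₂ , refl , i∉) =
            inj₂ (i , j , here , e , w₁ , w₂ , refl , All.¬Any⇒All¬ _ i∉ ∷ unique-++ˡ (subst Unique (path-++ w₁ w₂) u))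

  simplePath : ∀ {i j} → Reach R i j → ∃ λ (w : Reach R i j) → Unique (path w)
  simplePath here = here , [] ∷ []
  simplePath (step {i} e w) with simplePath w
  ... | w′ , u with splitAt i w′
  ...   | inj₁ i∉ = step e w′ , All.¬Any⇒All¬ _ i∉ ∷ u
  ...   | inj₂ (w₁ , w₂ , refl , _) = w₂ , unique-++ʳ (starts w₁) (subst Unique (path-++ w₁ w₂) u)

  closedPairs-loop : ∀ {x y} (e : R x y) (w : Reach R y x) → closedPairs (x ∷ starts w) ≡ pairs (path (step e w))
  closedPairs-loop {x} e w = closedPairs≡pairs x (starts w)

  isCycle-loop : ∀ {x y} (e : R x y) (w : Reach R y x) → 2 ≤ len w → Unique (x ∷ starts w) → IsCycle R (x ∷ starts w)
  isCycle-loop {x} e w 2≤len u = s≤s (subst (2 ≤_) (sym (length-starts w)) 2≤len) , u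
    , subst (All (uncurry R)) (sym (closedPairs-loop e w)) (pairs-path (step e w))
    where
    length-starts : ∀ {i j} (w : Reach R i j) → length (starts w) ≡ len w
    length-starts here       = refl
    length-starts (step e w) = cong suc (length-starts w)

open Walks

reverseReach : ∀ {n} {R : Fin n → Fin n → Set} → (∀ {i j} → R i j → R j i) → ∀ {i j} → Reach R i j → Reach R j i
reverseReach sy here       = here
reverseReach sy (step e w) = reverseReach sy w ++ʷ step (sy e) here

mapReach : ∀ {n} {R S : Fin n → Fin n → Set} → (∀ {i j} → R i j → S i j) → ∀ {i j} → Reach R i j → Reach S i j
mapReach f here       = here
mapReach f (step e w) = step (f e) (mapReach f w)

starts-mapReach : ∀ {n} {R S : Fin n → Fin n → Set} (f : ∀ {i j} → R i j → S i j) {i j} (w : Reach R i j)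
  → starts (mapReach {S = S} f w) ≡ starts w
starts-mapReach f here       = refl
starts-mapReach f (step e w) = cong (_ ∷_) (starts-mapReach f w)

-- Parent functions as undirected trees

module ParentMap {n} (p : Fin n → Maybe (Fin n)) where

  Link : Fin n → Fin n → Set
  Link v w = p v ≡ just w ⊎ p w ≡ just v

  link-sym : ∀ {v w} → Link v w → Link w v
  link-sym = Sum.swap

  isParent : Fin n → Fin n → Bool
  isParent v w = does (≡-dec _≟_ (p v) (just w))

  treeMatrix : Vec (Vec Bool n) n
  treeMatrix = Vec.tabulate (λ v → Vec.tabulate (λ w → isParent v w ∨ isParent w v))

  lookup-treeMatrix : ∀ v w → lookup (lookup treeMatrix v) w ≡ isParent v w ∨ isParent w v
  lookup-treeMatrix v w = trans (cong (λ r → lookup r w) (Vec.lookup∘tabulate _ v)) (Vec.lookup∘tabulate _ w)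

  isParent⁺ : ∀ {v w} → p v ≡ just w → isParent v w ≡ true
  isParent⁺ {v} {w} eq = dec-true (≡-dec _≟_ (p v) (just w)) eq

  isParent⁻ : ∀ {v w} → isParent v w ≡ true → p v ≡ just w
  isParent⁻ {v} {w} eq with ≡-dec _≟_ (p v) (just w)
  ... | yes e = e

  treeMatrix⇒link : ∀ {v w} → TAdj treeMatrix v w → Link v w
  treeMatrix⇒link {v} {w} t = from (isParent v w) (isParent w v) refl refl (trans (sym (lookup-treeMatrix v w)) t)
    where
    from : ∀ a b → isParent v w ≡ a → isParent w v ≡ b → a ∨ b ≡ true → Link v w
    from true  b    ea eb _ = inj₁ (isParent⁻ ea)
    from false true ea eb _ = inj₂ (isParent⁻ eb)

  link⇒treeMatrix : ∀ {v w} → Link v w → TAdj treeMatrix v w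
  link⇒treeMatrix {v} {w} (inj₁ e) = trans (lookup-treeMatrix v w) (cong (_∨ isParent w v) (isParent⁺ e))
  link⇒treeMatrix {v} {w} (inj₂ e) = trans (lookup-treeMatrix v w) (trans (∨-comm (isParent v w) (isParent w v)) (cong (_∨ isParent v w) (isParent⁺ e)))

  treeMatrix-symmetric : ∀ v w → lookup (lookup treeMatrix v) w ≡ lookup (lookup treeMatrix w) v
  treeMatrix-symmetric v w = trans (lookup-treeMatrix v w) (trans (∨-comm (isParent v w) (isParent w v)) (sym (lookup-treeMatrix w v)))

  module _ (d : Fin n → ℕ) (dec : ∀ {v w} → p v ≡ just w → d w < d v) where

    parent-unique : ∀ {v a b} → p v ≡ just a → p v ≡ just b → a ≡ b
    parent-unique e e′ = just-injective (trans (sym e) e′)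

    -- After a step from the parent `a` to its child `b`, a step to the parent of `b` would return
    -- to `a`. So the cycle keeps going to children, ranks keep growing, and it cannot close up at
    -- `x`, whose rank is at most that of `a`.
    descending : ∀ x a b r → All (uncurry Link) (pairs (a ∷ b ∷ r ++ x ∷ [])) → Unique (a ∷ b ∷ r)
      → a ≢ x → All (x ≢_) (b ∷ r) → d x ≤ d a → p b ≡ just a → ⊥
    descending x a b [] (_ ∷ inj₁ e ∷ _) _ a≢x _ _ pb = a≢x (parent-unique pb e)
    descending x a b [] (_ ∷ inj₂ e ∷ _) _ _ _ dx≤da pb = ℕP.<-irrefl refl (ℕP.<-≤-trans (ℕP.<-trans (dec pb) (dec e)) dx≤da)
    descending x a b (c ∷ r) (_ ∷ inj₁ e ∷ _) ((_ ∷ a≢c ∷ _) ∷ _) _ _ _ pb = a≢c (parent-unique pb e)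
    descending x a b (c ∷ r) (_ ∷ inj₂ e ∷ ls) (_ ∷ u) _ (x≢b ∷ x≢) dx≤da pb =
      descending x b c r (inj₂ e ∷ ls) u (≢-sym x≢b) x≢ (ℕP.≤-trans dx≤da (ℕP.<⇒≤ (dec pb))) e

    -- The successor on the cycle, which closes up at `x`.
    headOr : Fin n → List (Fin n) → Fin n
    headOr x []      = x
    headOr x (c ∷ r) = c

    -- The cycle leaves `x` towards its parent `y`, so it can only come back through a child of `x`.
    -- Read backwards from there, each vertex already has its successor as parent and cannot be a
    -- child of its predecessor, so every step goes to a parent.
    ascending : ∀ x y b r → All (uncurry Link) (pairs (b ∷ r ++ x ∷ [])) → Unique (b ∷ r)
      → All (x ≢_) (b ∷ r) → All (y ≢_) (b ∷ r) → p x ≡ just y → p b ≡ just (headOr x r) × d x < d b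
    ascending x y b [] (inj₁ e ∷ _) _ _ _ px = e , dec e
    ascending x y b [] (inj₂ e ∷ _) _ _ (y≢b ∷ _) px = contradiction (parent-unique px e) y≢b
    ascending x y b (c ∷ r) (l ∷ ls) ((b≢c ∷ b≢r) ∷ u) (x≢b ∷ x≢) (_ ∷ y≢) px
      with pc , dx<dc ← ascending x y c r ls u x≢ y≢ px
      with l
    ... | inj₁ e = e , ℕP.<-trans dx<dc (dec e)
    ... | inj₂ e = contradiction (parent-unique e pc) (b≢head r b≢r)
      where
      b≢head : ∀ r → All (b ≢_) r → b ≢ headOr x r
      b≢head []      _         = ≢-sym x≢b
      b≢head (_ ∷ _) (b≢c ∷ _) = b≢c

    -- The first link decides: a step to a child forces `descending`, a step to a parent forces
    -- `ascending`, and either way the ranks are monotone around a closed list.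
    acyclic : ∀ vs → ¬ IsCycle Link vs
    acyclic (x ∷ [])     (s≤s () , _)
    acyclic (x ∷ y ∷ []) (s≤s (s≤s ()) , _)
    acyclic (x ∷ y ∷ z ∷ r) (_ , u , ls) = go (subst (All (uncurry Link)) (closedPairs≡pairs x (y ∷ z ∷ r)) ls) u
      where
      go : All (uncurry Link) (pairs (x ∷ y ∷ z ∷ r ++ x ∷ [])) → Unique (x ∷ y ∷ z ∷ r) → ⊥
      go (inj₂ py ∷ inj₁ e ∷ _) ((_ ∷ x≢z ∷ _) ∷ _) = x≢z (parent-unique py e)
      go (inj₂ py ∷ inj₂ pz ∷ ls) ((x≢y ∷ x≢) ∷ u) =
        descending x y z r (inj₂ pz ∷ ls) u (≢-sym x≢y) x≢ (ℕP.<⇒≤ (dec py)) pz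
      go (inj₁ px ∷ l ∷ ls) ((x≢y ∷ x≢) ∷ y≢@(_ ∷ y≢r) ∷ u)
        with pz , dx<dz ← ascending x y z r ls u x≢ y≢ px
        with l
      ... | inj₁ py = ℕP.<-asym dx<dz (ℕP.<-trans (dec py) (dec px))
      ... | inj₂ e  = y≢head r y≢r (parent-unique e pz)
        where
        y≢head : ∀ r → All (y ≢_) r → y ≢ headOr x r
        y≢head []      _         = ≢-sym x≢y
        y≢head (_ ∷ _) (y≢c ∷ _) = y≢c

    reachRoot : ∀ ρ → (∀ v → p v ≡ nothing → v ≡ ρ) → ∀ k v → d v < k → Reach Link v ρ
    reachRoot ρ root (suc k) v (s≤s dv≤k) with p v in eq
    ... | nothing with refl ← root v eq = here
    ... | just w = step (inj₁ eq) (reachRoot ρ root k w (ℕP.<-≤-trans (dec eq) dv≤k))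

    connected : ∀ ρ → (∀ v → p v ≡ nothing → v ≡ ρ) → Connected Link
    connected ρ root i j = reachRoot ρ root (suc (d i)) i ℕP.≤-refl ++ʷ reverseReach link-sym (reachRoot ρ root (suc (d j)) j ℕP.≤-refl)

open ParentMap

-- A tree has only one orientation towards a given root. If `q` reversed the link from `v` to `w`,
-- then `w` would not be a root, and by induction on the rank `q` would agree with `p` at `w`; then
-- `v` and `w` would be parents of each other under `p`.
parentMap-determined : ∀ {n} (p q : Fin n → Maybe (Fin n)) (d : Fin n → ℕ)
  → (∀ {v w} → p v ≡ just w → d w < d v)
  → (∀ v → p v ≡ nothing → q v ≡ nothing)
  → (∀ {v w} → Link p v w → Link q v w)
  → ∀ k v w → d v < k → p v ≡ just w → q v ≡ just w
parentMap-determined p q d dec root incl (suc k) v w (s≤s dv≤k) pv with incl (inj₁ pv)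
... | inj₁ qv = qv
... | inj₂ qw with p w in pw
...   | nothing = contradiction (trans (sym (root w pw)) qw) λ ()
...   | just u with refl ← just-injective (trans (sym (parentMap-determined p q d dec root incl k w u (ℕP.<-≤-trans (dec pv) dv≤k) pw)) qw)
        = contradiction (dec pv) (ℕP.<-asym (dec pw))

-- An edge of R outside S would close a simple S-path between its ends to a cycle of R. This forces
-- the tree of a parent function chosen inside T to be all of T.
acyclic-maximal : ∀ {n} {R S : Fin n → Fin n → Set}
  → (∀ {i j} → S i j → R i j) → (∀ {i j} → R i j → R j i) → (∀ i → ¬ R i i) → (∀ vs → ¬ IsCycle R vs)
  → Connected S → (∀ {i j} → S i j → S j i) → ∀ {u v} → R u v → S u v
acyclic-maximal {R = R} {S} S⊆R R-sym R-irr noCycle conn S-sym {u} {v} uv with simplePath (conn v u)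
... | here , _ = contradiction uv (R-irr _)
... | step e here , _ = S-sym e
... | step e (step e′ w) , unique = contradiction (isCycle-loop (S⊆R e) loop 2≤len (subst Unique (sym starts-loop) unique)) (noCycle _)
  where
  w′ = mapReach {S = R} S⊆R w
  loop = step (S⊆R e′) (w′ ++ʷ step uv here)
  2≤len : 2 ≤ len loop
  2≤len = s≤s (subst (1 ≤_) (sym (len-++ w′ (step uv here))) (ℕP.m≤n+m 1 (len w′)))
  starts-loop : v ∷ starts loop ≡ path (step e (step e′ w))
  starts-loop = cong (λ ys → _ ∷ _ ∷ ys) (trans (starts-++ w′ (step uv here)) (cong (_++ u ∷ []) (starts-mapReach S⊆R w)))

least : ∀ {P : ℕ → Set} → Decidable P → ∀ k → P k → ∃ λ m → P m × (∀ j → P j → m ≤ j)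
least P? zero    pk = 0 , pk , λ _ _ → z≤n
least P? (suc k) pk with P? 0
... | yes p0 = 0 , p0 , λ _ _ → z≤n
... | no ¬p0 with m , pm , min ← least (P? ∘ suc) k pk = suc m , pm , λ { zero p0 → contradiction p0 ¬p0 ; (suc j) pj → s≤s (min j pj) }

vec-ext : ∀ {A : Set} {n} {xs ys : Vec A n} → (∀ i → lookup xs i ≡ lookup ys i) → xs ≡ ys
vec-ext {xs = xs} {ys} eq = trans (sym (Vec.tabulate∘lookup xs)) (trans (Vec.tabulate-cong eq) (Vec.tabulate∘lookup ys))

bool-ext : ∀ {a b} → (a ≡ true → b ≡ true) → (b ≡ true → a ≡ true) → a ≡ b
bool-ext {true}          f g = sym (f refl)
bool-ext {false} {true}  f g = g refl
bool-ext {false} {false} f g = refl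

module Distance {n} (T : Vec (Vec Bool n) n) (ρ : Fin n) (conn : Connected (TAdj T)) where

  -- A walk of exactly `k` steps to the root. Unlike `Reach` this is decidable, so minimal distances
  -- can be computed.
  Within : ℕ → Fin n → Set
  Within zero    v = v ≡ ρ
  Within (suc k) v = ∃ λ w → TAdj T v w × Within k w

  within? : ∀ k v → Dec (Within k v)
  within? zero    v = v ≟ ρ
  within? (suc k) v = any? (λ w → (lookup (lookup T v) w Bool.≟ true) ×-dec within? k w)

  within : ∀ {v} (w : Reach (TAdj T) v ρ) → Within (len w) v
  within here       = refl
  within (step e w) = _ , e , within w

  shortest : ∀ v → ∃ λ k → Within k v × (∀ j → Within j v → k ≤ j)
  shortest v = least (λ k → within? k v) (len (conn v ρ)) (within (conn v ρ))

  dist : Fin n → ℕ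
  dist v = proj₁ (shortest v)

  closer : ∀ v → v ≢ ρ → ∃ λ w → TAdj T v w × dist w < dist v
  closer v v≢ρ with shortest v
  ... | zero  , v≡ρ             , _ = contradiction v≡ρ v≢ρ
  ... | suc k , (w , vw , near) , _ = w , vw , s≤s (proj₂ (proj₂ (shortest w)) k near)

-- The partial inverse of `punchIn ρ`; as a `rep` it is the state in which nothing has been merged
-- yet.
position : ∀ {n} → Fin (suc n) → Fin (suc n) → Maybe (Fin n)
position          zero    zero    = nothing
position          zero    (suc v) = just v
position {suc n}  (suc ρ) zero    = just zero
position {suc n}  (suc ρ) (suc v) = Maybe.map suc (position ρ v)

position-root : ∀ {n} (ρ : Fin (suc n)) → position ρ ρ ≡ nothing
position-root         zero    = refl
position-root {suc n} (suc ρ) = cong (Maybe.map suc) (position-root ρ)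

position-punchIn : ∀ {n} (ρ : Fin (suc n)) i → position ρ (punchIn ρ i) ≡ just i
position-punchIn         zero    i       = refl
position-punchIn {suc n} (suc ρ) zero    = refl
position-punchIn {suc n} (suc ρ) (suc i) = cong (Maybe.map suc) (position-punchIn ρ i)

data RootView {n} (ρ : Fin (suc n)) : Fin (suc n) → Set where
  root  : RootView ρ ρ
  other : ∀ i → RootView ρ (punchIn ρ i)

rootView : ∀ {n} (ρ v : Fin (suc n)) → RootView ρ v
rootView         zero    zero    = root
rootView         zero    (suc v) = other v
rootView {suc n} (suc ρ) zero    = other zero
rootView {suc n} (suc ρ) (suc v) with rootView ρ v
... | root    = root
... | other i = other (suc i)

present : EdgeSt → Bool
present none  = false
present undir = true
present fwd   = true
present bwd   = true

hasEdge : ∀ {n} → MixedGraph n → Fin n → Fin n → Bool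
hasEdge M i j = present (st M i j)

hasEdge⇒adj : ∀ {n} (M : MixedGraph n) {i j} → hasEdge M i j ≡ true → Adj M i j
hasEdge⇒adj M {i} {j} h eq with st M i j
hasEdge⇒adj M {i} {j} () refl | none

adj⇒hasEdge : ∀ {n} (M : MixedGraph n) {i j} → Adj M i j → hasEdge M i j ≡ true
adj⇒hasEdge M {i} {j} a with st M i j
... | none  = contradiction refl a
... | undir = refl
... | fwd   = refl
... | bwd   = refl

adj-sym : ∀ {n} (M : MixedGraph n) {i j} → Adj M i j → Adj M j i
adj-sym M {i} {j} a ji = a (trans (st-rev M j i) (cong rev ji))

adj-irrefl : ∀ {n} (M : MixedGraph n) i → ¬ Adj M i i
adj-irrefl M i a = a (st-loop M i)

-- Spanning trees with a chosen root

module RootedTrees {m} (M : MixedGraph (suc m)) (ρ : Fin (suc m)) where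

  parent : Vec (Fin (suc m)) m → Fin (suc m) → Maybe (Fin (suc m))
  parent f v = Maybe.map (lookup f) (position ρ v)

  parent-root : ∀ f v → parent f v ≡ nothing → v ≡ ρ
  parent-root f v eq with rootView ρ v
  ... | root    = refl
  ... | other i = contradiction (trans (sym eq) (cong (Maybe.map (lookup f)) (position-punchIn ρ i))) λ ()

  parent-ρ : ∀ f → parent f ρ ≡ nothing
  parent-ρ f = cong (Maybe.map (lookup f)) (position-root ρ)

  parent-punchIn : ∀ f i → parent f (punchIn ρ i) ≡ just (lookup f i)
  parent-punchIn f i = cong (Maybe.map (lookup f)) (position-punchIn ρ i)

  parent≡just : ∀ f {v w} → parent f v ≡ just w → ∃ λ i → v ≡ punchIn ρ i × w ≡ lookup f i
  parent≡just f {v} eq with rootView ρ v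
  ... | root    = contradiction (trans (sym eq) (parent-ρ f)) λ ()
  ... | other i = i , refl , just-injective (trans (sym eq) (parent-punchIn f i))

  edgeFrom : Fin m → Fin (suc m) → Bool
  edgeFrom i = hasEdge M (punchIn ρ i)

  vectors : List (Vec (Fin (suc m)) m)
  vectors = parentVectors m edgeFrom (position ρ)

  Depth : Vec (Fin (suc m)) m → Set
  Depth f = ∃ λ (d : Fin (suc m) → ℕ) → ∀ {v w} → parent f v ≡ just w → d w < d v

  depth : ∀ f → Ranked (λ i → position ρ (lookup f i)) → Depth f
  depth f (d , dec) = D , D-dec
    where
    height : Maybe (Fin m) → ℕ
    -- The root carries no rank in `Ranked`; it goes below all others, which move up by one.
    height nothing  = 0
    height (just i) = suc (d i)
    D : Fin (suc m) → ℕ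
    D v = height (position ρ v)
    lower : ∀ i t → position ρ (lookup f i) ≡ t → height t < suc (d i)
    lower i nothing  eq = s≤s z≤n
    lower i (just j) eq = s≤s (dec eq)
    D-dec : ∀ {v w} → parent f v ≡ just w → D w < D v
    D-dec eq with i , refl , refl ← parent≡just f eq =
      subst (D (lookup f i) <_) (cong height (sym (position-punchIn ρ i))) (lower i (position ρ (lookup f i)) refl)

  ranked : ∀ f → Depth f → Ranked (λ i → position ρ (lookup f i))
  ranked f (D , D-dec) = (λ i → D (punchIn ρ i)) , dec
    where
    dec : ∀ {i j} → position ρ (lookup f i) ≡ just j → D (punchIn ρ j) < D (punchIn ρ i)
    dec {i} {j} eq = subst (λ w → D w < D (punchIn ρ i)) (locate (lookup f i) eq) (D-dec (parent-punchIn f i))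
      where
      locate : ∀ w → position ρ w ≡ just j → w ≡ punchIn ρ j
      locate w e with rootView ρ w
      ... | root     = contradiction (trans (sym e) (position-root ρ)) λ ()
      ... | other j′ = cong (punchIn ρ) (just-injective (trans (sym (position-punchIn ρ j′)) e))

  tree : Vec (Fin (suc m)) m → Vec (Vec Bool (suc m)) (suc m)
  tree f = treeMatrix (parent f)

  trees : List (Vec (Vec Bool (suc m)) (suc m))
  trees = map tree vectors

  link⇒adj : ∀ f → (∀ i → edgeFrom i (lookup f i) ≡ true) → ∀ {v w} → Link (parent f) v w → Adj M v w
  link⇒adj f edges (inj₁ e) with i , refl , refl ← parent≡just f e = hasEdge⇒adj M (edges i)
  link⇒adj f edges (inj₂ e) with i , refl , refl ← parent≡just f e = adj-sym M (hasEdge⇒adj M (edges i))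

  sound : ∀ {f} → f ∈ vectors → IsSpanningTree M (tree f)
  sound {f} f∈
    with edges , rk ← ∈-parentVectors⁻ m edgeFrom (position ρ) f∈
    with D , D-dec ← depth f rk
    = treeMatrix-symmetric p
    , (λ v w t → link⇒adj f edges (treeMatrix⇒link p t))
    , (λ i j → mapReach (link⇒treeMatrix p) (connected p D D-dec ρ (parent-root f) i j))
    , (λ vs (3≤ , u , ls) → acyclic p D D-dec vs (3≤ , u , All.map (treeMatrix⇒link p) ls))
    where p = parent f

  tree-injective : ∀ {f g} → f ∈ vectors → tree f ≡ tree g → f ≡ g
  tree-injective {f} {g} f∈ eq
    with edges , rk ← ∈-parentVectors⁻ m edgeFrom (position ρ) f∈
    with D , D-dec ← depth f rk
    = vec-ext (λ i → sym (just-injective (trans (sym (parent-punchIn g i))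
        (parentMap-determined (parent f) (parent g) D D-dec sameRoot incl (suc (D (punchIn ρ i))) (punchIn ρ i) (lookup f i) ℕP.≤-refl (parent-punchIn f i)))))
    where
    sameRoot : ∀ v → parent f v ≡ nothing → parent g v ≡ nothing
    sameRoot v e = trans (cong (parent g) (parent-root f v e)) (parent-ρ g)
    incl : ∀ {v w} → Link (parent f) v w → Link (parent g) v w
    incl {v} {w} l = treeMatrix⇒link (parent g) (subst (λ T → TAdj T v w) eq (link⇒treeMatrix (parent f) l))

  trees-unique : Unique trees
  trees-unique = unique-map vectors (λ f∈ → f∈) (parentVectors-unique m edgeFrom (position ρ))
    where
    unique-map : ∀ fs → (∀ {f} → f ∈ fs → f ∈ vectors) → Unique fs → Unique (map tree fs)
    unique-map []       ⊆ []       = []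
    unique-map (f ∷ fs) ⊆ (f≢ ∷ u) = All.map⁺ (All.map (λ f≢g eq → f≢g (tree-injective (⊆ (here refl)) eq)) f≢) ∷ unique-map fs (⊆ ∘ there) u

  -- Sending each vertex to a neighbour in T that is nearer to the root gives a parent function with
  -- the distance as rank. Its tree is connected and lies in T, so acyclicity of T makes the two
  -- equal.
  complete : ∀ T → IsSpanningTree M T → T ∈ trees
  complete T (T-sym , T⊆M , conn , noCycle) = subst (_∈ trees) tree≡T (∈-map⁺ tree f∈)
    where
    open Distance T ρ conn
    next : ∀ i → ∃ λ w → TAdj T (punchIn ρ i) w × dist w < dist (punchIn ρ i)
    next i = closer (punchIn ρ i) (punchInᵢ≢i ρ i)
    f : Vec (Fin (suc m)) m
    f = Vec.tabulate (λ i → proj₁ (next i))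
    next-f : ∀ i → TAdj T (punchIn ρ i) (lookup f i) × dist (lookup f i) < dist (punchIn ρ i)
    next-f i = subst (λ w → TAdj T (punchIn ρ i) w × dist w < dist (punchIn ρ i)) (sym (Vec.lookup∘tabulate (λ i → proj₁ (next i)) i)) (proj₂ (next i))
    dec : ∀ {v w} → parent f v ≡ just w → dist w < dist v
    dec e with i , refl , refl ← parent≡just f e = proj₂ (next-f i)
    f∈ : f ∈ vectors
    f∈ = ∈-parentVectors⁺ m edgeFrom (position ρ) f (λ i → adj⇒hasEdge M (T⊆M _ _ (proj₁ (next-f i)))) (ranked f (dist , dec))
    T-flip : ∀ {v w} → TAdj T v w → TAdj T w v
    T-flip {v} {w} t = trans (T-sym w v) t
    link⇒T : ∀ {v w} → Link (parent f) v w → TAdj T v w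
    link⇒T (inj₁ e) with i , refl , refl ← parent≡just f e = proj₁ (next-f i)
    link⇒T (inj₂ e) with i , refl , refl ← parent≡just f e = T-flip (proj₁ (next-f i))
    T⇒link : ∀ {v w} → TAdj T v w → Link (parent f) v w
    T⇒link = acyclic-maximal link⇒T T-flip (λ i t → adj-irrefl M i (T⊆M i i t)) noCycle
      (connected (parent f) dist dec ρ (parent-root f)) (link-sym (parent f))
    tree≡T : tree f ≡ T
    tree≡T = vec-ext (λ v → vec-ext (λ w → bool-ext (λ t → link⇒T (treeMatrix⇒link (parent f) t)) (λ t → link⇒treeMatrix (parent f) (T⇒link t))))

  trees⇔spanning : ∀ T → (T ∈ trees) ⇔ IsSpanningTree M T
  trees⇔spanning T = mk⇔ (λ T∈ → let (f , f∈ , eq) = ∈-map⁻ tree T∈ in subst (IsSpanningTree M) (sym eq) (sound f∈)) (complete T)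

-- The Laplacian

δ-sym : ∀ {n} (i j : Fin n) → δ i j ≡ δ j i
δ-sym zero    zero    = refl
δ-sym zero    (suc j) = refl
δ-sym (suc i) zero    = refl
δ-sym (suc i) (suc j) = δ-sym i j

δ-position : ∀ {m} (ρ v : Fin (suc m)) c → δ v (punchIn ρ c) ≡ δᴹ (position ρ v) c
δ-position ρ v c with rootView ρ v
... | root    = trans (δ-≢ (λ e → punchInᵢ≢i ρ c (sym e))) (cong (λ t → δᴹ t c) (sym (position-root ρ)))
... | other i = trans (δ-punchIn ρ i c) (cong (λ t → δᴹ t c) (sym (position-punchIn ρ i)))

module Laplacian {m} (M : MixedGraph (suc m)) where
  open ≡-Reasoning

  adj : Fin (suc m) → Fin (suc m) → ℤω
  adj i v = ⟦ hasEdge M i v ⟧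

  -- Degree minus adjacency, as `laplacian-entry` shows. Written as a sum over possible arrows, it
  -- has zero row sums and agrees with `mergedLaplacian` term by term.
  laplacian : Matrix (suc m)
  laplacian i j = sum (λ v → adj i v *ω (δ i j +ω -ω δ v j))

  laplacian-zeroRowSums : ∀ i → sum (laplacian i) ≡ 0ω
  laplacian-zeroRowSums i = begin
    sum (λ j → sum (λ v → adj i v *ω (δ i j +ω -ω δ v j)))  ≡⟨ ∑-comm (λ j v → adj i v *ω (δ i j +ω -ω δ v j)) ⟩
    sum (λ v → sum (λ j → adj i v *ω (δ i j +ω -ω δ v j)))  ≡⟨ sum-cong-≗ vanish ⟩
    sum {suc m} (λ v → 0ω)                                  ≡⟨ sum-replicate-zero (suc m) ⟩
    0ω                                                      ∎
    where
    split : ∀ a x y → a *ω (x +ω -ω y) ≡ x *ω a +ω y *ω (-ω a)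
    split = solve-∀ ℤω-ring
    vanish : ∀ v → sum (λ j → adj i v *ω (δ i j +ω -ω δ v j)) ≡ 0ω
    vanish v = begin
      sum (λ j → a *ω (δ i j +ω -ω δ v j))                   ≡⟨ sum-cong-≗ (λ j → split a (δ i j) (δ v j)) ⟩
      sum (λ j → δ i j *ω a +ω δ v j *ω (-ω a))              ≡⟨ ∑-distrib-+ (λ j → δ i j *ω a) (λ j → δ v j *ω (-ω a)) ⟩
      sum (λ j → δ i j *ω a) +ω sum (λ j → δ v j *ω (-ω a))  ≡⟨ cong₂ _+ω_ (sum-δ i (λ _ → a)) (sum-δ v (λ _ → -ω a)) ⟩
      a +ω -ω a                                              ≡⟨ -‿inverseʳ a ⟩
      0ω                                                     ∎
      where a = adj i v

  laplacian-reduced : ∀ ρ r c → laplacian (punchIn ρ r) (punchIn ρ c) ≡ mergedLaplacian (RootedTrees.edgeFrom M ρ) (position ρ) r c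
  laplacian-reduced ρ r c = sum-cong-≗ (λ v → cong₂ (λ x y → adj (punchIn ρ r) v *ω (x +ω -ω y)) (δ-punchIn ρ r c) (δ-position ρ v c))

  cofactor-laplacian : ∀ i j → cofactor m laplacian i j ≡ fromℕω (length (RootedTrees.trees M i))
  cofactor-laplacian i j = begin
    sign (toℕ i ℕ.+ toℕ j) *ω colMinor B j   ≡⟨ signs j ⟩
    sign (toℕ i) *ω signedMinor B j          ≡⟨ cong (sign (toℕ i) *ω_) (trans (constant j) (sym (constant i))) ⟩
    sign (toℕ i) *ω signedMinor B i          ≡⟨ signs i ⟨
    sign (toℕ i ℕ.+ toℕ i) *ω colMinor B i   ≡⟨ cong (_*ω colMinor B i) (sign-double (toℕ i)) ⟩
    1ω *ω colMinor B i                       ≡⟨ *ω-identityˡ (colMinor B i) ⟩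
    colMinor B i                             ≡⟨ det-cong m (laplacian-reduced i) ⟩
    det m (mergedLaplacian edgeFrom (position i))  ≡⟨ det-mergedLaplacian m edgeFrom (position i) ⟩
    fromℕω (length vectors)                  ≡⟨ cong fromℕω (length-map tree vectors) ⟨
    fromℕω (length trees)                    ∎
    where
    open RootedTrees M i
    B : Fin m → Fin (suc m) → ℤω
    B r = laplacian (punchIn i r)
    constant : ∀ j → signedMinor B j ≡ signedMinor B zero
    constant = signedMinor-constant m B (λ r → laplacian-zeroRowSums (punchIn i r))
    signs : ∀ j → sign (toℕ i ℕ.+ toℕ j) *ω colMinor B j ≡ sign (toℕ i) *ω signedMinor B j
    signs j = trans (cong (_*ω colMinor B j) (sign-+ (toℕ i) (toℕ j))) (*ω-assoc (sign (toℕ i)) (sign (toℕ j)) (colMinor B j))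

  degree-sum : ∀ i → fromℕω (degree M i) ≡ sum (adj i)
  degree-sum i = total (suc m) (λ v → v)
    where
    weight : ∀ s → fromℕω (isEdge s) ≡ ⟦ present s ⟧
    weight none  = refl
    weight undir = refl
    weight fwd   = refl
    weight bwd   = refl
    total : ∀ k (h : Fin k → Fin (suc m)) → fromℕω (ℕ.sum (map (λ j → isEdge (st M i j)) (tabulate h))) ≡ sum (λ v → adj i (h v))
    total zero    h = refl
    total (suc k) h = cong₂ _+ω_ (weight (st M i (h zero))) (total k (λ v → h (suc v)))

  laplacian-entry : ∀ i j → laplacian i j ≡ δ i j *ω fromℕω (degree M i) +ω -ω adj i j
  laplacian-entry i j = begin
    sum (λ v → adj i v *ω (δ i j +ω -ω δ v j))
      ≡⟨ sum-cong-≗ (λ v → trans (cong (λ d → adj i v *ω (δ i j +ω -ω d)) (δ-sym v j)) (split (adj i v) (δ i j) (δ j v))) ⟩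
    sum (λ v → δ i j *ω adj i v +ω δ j v *ω (-ω adj i v))
      ≡⟨ ∑-distrib-+ (λ v → δ i j *ω adj i v) (λ v → δ j v *ω (-ω adj i v)) ⟩
    sum (λ v → δ i j *ω adj i v) +ω sum (λ v → δ j v *ω (-ω adj i v))
      ≡⟨ cong₂ _+ω_ (sym (*-distribˡ-sum (δ i j) (adj i))) (sum-δ j (λ v → -ω adj i v)) ⟩
    δ i j *ω sum (adj i) +ω -ω adj i j
      ≡⟨ cong (λ d → δ i j *ω d +ω -ω adj i j) (degree-sum i) ⟨
    δ i j *ω fromℕω (degree M i) +ω -ω adj i j ∎
    where
    split : ∀ a x y → a *ω (x +ω -ω y) ≡ x *ω a +ω y *ω (-ω a)
    split = solve-∀ ℤω-ring

-- Switching

-- Complex conjugation, which sends ω to 1 - ω.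
conj : ℤω → ℤω
conj (mkℤω a b) = mkℤω (a ℤ.+ b) (ℤ.- b)

conj-* : ∀ x → conj x *ω x ≡ mkℤω (absSq x) (+ 0)
conj-* (mkℤω a b) = cong₂ mkℤω (re-eq a b) (im-eq a b)
  where
  re-eq : ∀ a b → (a ℤ.+ b) ℤ.* a ℤ.- (ℤ.- b) ℤ.* b ≡ a ℤ.* a ℤ.+ a ℤ.* b ℤ.+ b ℤ.* b
  re-eq = ℤSolver.solve-∀
  im-eq : ∀ a b → (a ℤ.+ b) ℤ.* b ℤ.+ (ℤ.- b) ℤ.* a ℤ.+ (ℤ.- b) ℤ.* b ≡ + 0
  im-eq = ℤSolver.solve-∀

absSq-* : ∀ x y → absSq (x *ω y) ≡ absSq x ℤ.* absSq y
absSq-* (mkℤω a b) (mkℤω c d) = eq a b c d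
  where
  eq : ∀ a b c d → let p = a ℤ.* c ℤ.- b ℤ.* d; q = a ℤ.* d ℤ.+ b ℤ.* c ℤ.+ b ℤ.* d in
       p ℤ.* p ℤ.+ p ℤ.* q ℤ.+ q ℤ.* q ≡ (a ℤ.* a ℤ.+ a ℤ.* b ℤ.+ b ℤ.* b) ℤ.* (c ℤ.* c ℤ.+ c ℤ.* d ℤ.+ d ℤ.* d)
  eq = ℤSolver.solve-∀

absSq-conj : ∀ x → absSq (conj x) ≡ absSq x
absSq-conj (mkℤω a b) = eq a b
  where
  eq : ∀ a b → (a ℤ.+ b) ℤ.* (a ℤ.+ b) ℤ.+ (a ℤ.+ b) ℤ.* (ℤ.- b) ℤ.+ (ℤ.- b) ℤ.* (ℤ.- b) ≡ a ℤ.* a ℤ.+ a ℤ.* b ℤ.+ b ℤ.* b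
  eq = ℤSolver.solve-∀

absSq-fromℕω : ∀ k → absSq (fromℕω k) ≡ + (k ℕ.* k)
absSq-fromℕω k = trans (eq (+ k)) (sym (ℤP.pos-* k k))
  where
  eq : ∀ a → a ℤ.* a ℤ.+ a ℤ.* + 0 ℤ.+ + 0 ℤ.* + 0 ≡ a ℤ.* a
  eq = ℤSolver.solve-∀

absSq-unit-* : ∀ x y → absSq x ≡ + 1 → absSq (x *ω y) ≡ absSq y
absSq-unit-* x y eq = trans (absSq-* x y) (trans (cong (ℤ._* absSq y) eq) (ℤP.*-identityˡ (absSq y)))

absSq-prod : ∀ {n} (x : Fin n → ℤω) → (∀ i → absSq (x i) ≡ + 1) → absSq (prod x) ≡ + 1
absSq-prod {zero}  x unit = refl
absSq-prod {suc n} x unit = trans (absSq-unit-* (x zero) (prod (λ i → x (suc i))) (unit zero)) (absSq-prod (λ i → x (suc i)) (λ i → unit (suc i)))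

-- Gains of closed walks

module Gain {n} {R : Fin n → Fin n → Set} (g : Fin n → Fin n → ℤω) where

  gainPairs : List (Fin n × Fin n) → ℤω
  gainPairs []             = 1ω
  gainPairs ((i , j) ∷ ps) = g i j *ω gainPairs ps

  gain : ∀ {i j} → Reach R i j → ℤω
  gain here               = 1ω
  gain (step {i} {j} e w) = g i j *ω gain w

  gain-path : ∀ {i j} (w : Reach R i j) → gain w ≡ gainPairs (pairs (path w))
  gain-path here                 = refl
  gain-path (step e here)        = refl
  gain-path (step e (step e′ w)) = cong (g _ _ *ω_) (gain-path (step e′ w))

  gain-++ : ∀ {i j k} (w₁ : Reach R i j) (w₂ : Reach R j k) → gain (w₁ ++ʷ w₂) ≡ gain w₁ *ω gain w₂
  gain-++ here        w₂ = sym (*ω-identityˡ (gain w₂))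
  gain-++ (step e w₁) w₂ = trans (cong (g _ _ *ω_) (gain-++ w₁ w₂)) (sym (*ω-assoc (g _ _) (gain w₁) (gain w₂)))

  module _ (simpleLoops : ∀ {x y} (e : R x y) (w : Reach R y x) → Unique (x ∷ starts w) → g x y *ω gain w ≡ 1ω) where
    open ≡-Reasoning

    -- Cutting out a simple loop changes no gain and shortens the walk; the bound `k` carries the
    -- induction, as the rest is not a subwalk.
    gain-closed-bounded : ∀ k {i} (w : Reach R i i) → len w ≤ k → gain w ≡ 1ω
    gain-closed-bounded k here _ = refl
    gain-closed-bounded (suc k) w₀@(step e w) (s≤s len≤k) with findLoop w₀
    -- A closed walk with at least one step repeats its base point.
    ... | inj₁ (i≢ ∷ _) = contradiction (end∈path w) (All.All¬⇒¬Any i≢)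
    ... | inj₂ (y , z , pre , e′ , loop , post , eq , u) = begin
      gain w₀                                           ≡⟨ cong gain eq ⟩
      gain (pre ++ʷ step e′ loop ++ʷ post)              ≡⟨ gain-++ pre (step e′ loop ++ʷ post) ⟩
      gain pre *ω gain (step e′ loop ++ʷ post)          ≡⟨ cong (gain pre *ω_) (gain-++ (step e′ loop) post) ⟩
      gain pre *ω ((g y z *ω gain loop) *ω gain post)   ≡⟨ cong (λ x → gain pre *ω (x *ω gain post)) (simpleLoops e′ loop u) ⟩
      gain pre *ω (1ω *ω gain post)                     ≡⟨ cong (gain pre *ω_) (*ω-identityˡ (gain post)) ⟩
      gain pre *ω gain post                             ≡⟨ gain-++ pre post ⟨
      gain (pre ++ʷ post)                               ≡⟨ gain-closed-bounded k (pre ++ʷ post) shorter ⟩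
      1ω                                                ∎
      where
      total : len pre ℕ.+ suc (len loop ℕ.+ len post) ≡ suc (len w)
      total = sym (trans (cong len eq) (trans (len-++ pre (step e′ loop ++ʷ post)) (cong (λ l → len pre ℕ.+ suc l) (len-++ loop post))))
      shorter : len (pre ++ʷ post) ≤ k
      shorter = ℕP.≤-trans (ℕP.≤-reflexive (len-++ pre post)) (ℕP.≤-trans
        (ℕP.+-monoʳ-≤ (len pre) (ℕP.m≤n+m (len post) (len loop)))
        (ℕP.≤-trans (ℕP.≤-reflexive (ℕP.suc-injective (trans (sym (ℕP.+-suc (len pre) _)) total))) len≤k))

    gain-closed : ∀ {i} (w : Reach R i i) → gain w ≡ 1ω
    gain-closed w = gain-closed-bounded (len w) w ℕP.≤-refl

-- Negating ω makes the directed edges contribute primitive cube roots of unity.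
ζ ζ̄ : ℤω
ζ = -ω ω
ζ̄ = -ω ω̄

power-inverse : ∀ x y → x *ω y ≡ 1ω → ∀ k → x ^ k *ω y ^ k ≡ 1ω
power-inverse x y xy zero    = refl
power-inverse x y xy (suc k) = trans (regroup x y (x ^ k) (y ^ k)) (cong₂ _*ω_ xy (power-inverse x y xy k))
  where
  regroup : ∀ x y u v → (x *ω u) *ω (y *ω v) ≡ (x *ω y) *ω (u *ω v)
  regroup = solve-∀ ℤω-ring

power-cube : ∀ x → x ^ 3 ≡ 1ω → ∀ k → x ^ (k ℕ.* 3) ≡ 1ω
power-cube x x³ zero    = refl
power-cube x x³ (suc k) = trans (^-homo-* x 3 (k ℕ.* 3)) (cong₂ _*ω_ x³ (power-cube x x³ k))

balanced-powers : ∀ x y → x *ω y ≡ 1ω → x ^ 3 ≡ 1ω → ∀ k b → x ^ (k ℕ.* 3 ℕ.+ b) *ω y ^ b ≡ 1ω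
balanced-powers x y xy x³ k b = begin
  x ^ (k ℕ.* 3 ℕ.+ b) *ω y ^ b        ≡⟨ cong (_*ω y ^ b) (^-homo-* x (k ℕ.* 3) b) ⟩
  x ^ (k ℕ.* 3) *ω x ^ b *ω y ^ b     ≡⟨ *ω-assoc (x ^ (k ℕ.* 3)) (x ^ b) (y ^ b) ⟩
  x ^ (k ℕ.* 3) *ω (x ^ b *ω y ^ b)   ≡⟨ cong₂ _*ω_ (power-cube x x³ k) (power-inverse x y xy b) ⟩
  1ω                                  ∎
  where open ≡-Reasoning

mod6⇒multiple3 : ∀ z → z %ℕ 6 ≡ 0 ⊎ z %ℕ 6 ≡ 3 → ∃ λ k → z ≡ k ℤ.* + 3
mod6⇒multiple3 z (inj₁ r) = (z /ℕ 6) ℤ.* + 2 , trans (a≡a%ℕn+[a/ℕn]*n z 6) (trans (cong (λ r → + r ℤ.+ (z /ℕ 6) ℤ.* + 6) r) (eq (z /ℕ 6)))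
  where
  eq : ∀ q → + 0 ℤ.+ q ℤ.* + 6 ≡ q ℤ.* + 2 ℤ.* + 3
  eq = ℤSolver.solve-∀
mod6⇒multiple3 z (inj₂ r) = (z /ℕ 6) ℤ.* + 2 ℤ.+ + 1 , trans (a≡a%ℕn+[a/ℕn]*n z 6) (trans (cong (λ r → + r ℤ.+ (z /ℕ 6) ℤ.* + 6) r) (eq (z /ℕ 6)))
  where
  eq : ∀ q → + 3 ℤ.+ q ℤ.* + 6 ≡ (q ℤ.* + 2 ℤ.+ + 1) ℤ.* + 3
  eq = ℤSolver.solve-∀

-- As `ζ` and `ζ̄` are inverse and have cube 1, only a - b modulo 3 matters. The sign of a - b tells
-- which exponent exceeds the other by a multiple of 3.
directed-gain : ∀ a b → (let r = (+ a ℤ.- + b) %ℕ 6 in r ≡ 0 ⊎ r ≡ 3) → ζ ^ a *ω ζ̄ ^ b ≡ 1ω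
directed-gain a b r with mod6⇒multiple3 (+ a ℤ.- + b) r
... | + k , eq = subst (λ a → ζ ^ a *ω ζ̄ ^ b ≡ 1ω) (sym a≡) (balanced-powers ζ ζ̄ refl refl k b)
  where
  cancel : ∀ x y → x ≡ x ℤ.- y ℤ.+ y
  cancel = ℤSolver.solve-∀
  a≡ : a ≡ k ℕ.* 3 ℕ.+ b
  a≡ = ℤP.+-injective (trans (cancel (+ a) (+ b)) (cong (ℤ._+ + b) (trans eq (sym (ℤP.pos-* k 3)))))
... | -[1+ k ] , eq = subst (λ b → ζ ^ a *ω ζ̄ ^ b ≡ 1ω) (sym b≡) (trans (*ω-comm (ζ ^ a) _) (balanced-powers ζ̄ ζ refl refl (suc k) a))
  where
  cancel : ∀ x y → y ≡ ℤ.- (x ℤ.- y) ℤ.+ x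
  cancel = ℤSolver.solve-∀
  b≡ : b ≡ suc k ℕ.* 3 ℕ.+ a
  b≡ = ℤP.+-injective (trans (cancel (+ a) (+ b)) (cong (ℤ._+ + a)
    (trans (cong ℤ.-_ eq) (trans (ℤP.neg-distribˡ-* -[1+ k ] (+ 3)) (sym (ℤP.pos-* (suc k) 3))))))

sign-even : ∀ {c} → 2 ∣ c → sign c ≡ 1ω
sign-even (divides q refl) = even q
  where
  even : ∀ q → sign (q ℕ.* 2) ≡ 1ω
  even zero    = refl
  even (suc q) = even q

-- From Q to the Laplacian

module Switching {m} (M : MixedGraph (suc m)) (conn : Connected (Adj M)) (cycles : ∀ vs → IsCycle (Adj M) vs → InΨ₄ M vs) where
  open ≡-Reasoning
  open Laplacian M

  g : Fin (suc m) → Fin (suc m) → ℤω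
  g i j = -ω nEntry (st M i j)

  open Gain {R = Adj M} g

  count : EdgeSt → List (Fin (suc m) × Fin (suc m)) → ℕ
  count s ps = ℕ.sum (map (λ p → countSt s (st M (proj₁ p) (proj₂ p))) ps)

  gainPairs-count : ∀ ps → All (λ p → Adj M (proj₁ p) (proj₂ p)) ps
    → gainPairs ps ≡ ζ ^ count fwd ps *ω ζ̄ ^ count bwd ps *ω sign (count undir ps)
  gainPairs-count [] [] = refl
  gainPairs-count ((i , j) ∷ ps) (e ∷ es) = trans (cong (g i j *ω_) (gainPairs-count ps es)) (add (st M i j) e)
    where
    a = count fwd ps
    b = count bwd ps
    c = count undir ps
    add-fwd : ∀ z u v s → z *ω (u *ω v *ω s) ≡ (z *ω u) *ω v *ω s
    add-fwd = solve-∀ ℤω-ring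
    add-bwd : ∀ z u v s → z *ω (u *ω v *ω s) ≡ u *ω (z *ω v) *ω s
    add-bwd = solve-∀ ℤω-ring
    add-undir : ∀ u v s → (-ω 1ω) *ω (u *ω v *ω s) ≡ u *ω v *ω (-ω s)
    add-undir = solve-∀ ℤω-ring
    add : ∀ s → s ≢ none → (-ω nEntry s) *ω (ζ ^ a *ω ζ̄ ^ b *ω sign c)
        ≡ ζ ^ (countSt fwd s ℕ.+ a) *ω ζ̄ ^ (countSt bwd s ℕ.+ b) *ω sign (countSt undir s ℕ.+ c)
    add none  s≢ = contradiction refl s≢
    add undir _  = trans (add-undir (ζ ^ a) (ζ̄ ^ b) (sign c)) (cong (ζ ^ a *ω ζ̄ ^ b *ω_) (sym (sign-suc c)))
    add fwd   _  = add-fwd ζ (ζ ^ a) (ζ̄ ^ b) (sign c)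
    add bwd   _  = add-bwd ζ̄ (ζ ^ a) (ζ̄ ^ b) (sign c)

  -- The two clauses of Ψ₄ each trivialise one factor: the cube roots of unity from directed edges
  -- and the sign from undirected ones.
  cycle-gain : ∀ vs → IsCycle (Adj M) vs → gainPairs (closedPairs vs) ≡ 1ω
  cycle-gain vs cyc@(_ , _ , es) with directed , undirected ← cycles vs cyc = begin
    gainPairs (closedPairs vs)            ≡⟨ gainPairs-count (closedPairs vs) es ⟩
    ζ ^ a *ω ζ̄ ^ b *ω sign c              ≡⟨ cong₂ _*ω_ (directed-gain a b directed) (sign-even undirected) ⟩
    1ω                                    ∎
    where
    a = countAlong M fwd vs
    b = countAlong M bwd vs
    c = countAlong M undir vs

  backtrack : ∀ {i j} → Adj M i j → g i j *ω g j i ≡ 1ω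
  backtrack {i} {j} e = trans (cong (λ s → g i j *ω (-ω nEntry s)) (st-rev M i j)) (unit (st M i j) e)
    where
    unit : ∀ s → s ≢ none → (-ω nEntry s) *ω (-ω nEntry (rev s)) ≡ 1ω
    unit none  s≢ = contradiction refl s≢
    unit undir _  = refl
    unit fwd   _  = refl
    unit bwd   _  = refl

  -- One step is impossible in a simple graph, two steps run along an edge and back, and from three
  -- steps on the loop is a cycle of the graph.
  loop-gain : ∀ {x y} (e : Adj M x y) (w : Reach (Adj M) y x) → Unique (x ∷ starts w) → g x y *ω gain w ≡ 1ω
  loop-gain e here _ = contradiction e (adj-irrefl M _)
  loop-gain {x} {y} e (step e′ here) _ = trans (cong (g x y *ω_) (*-identityʳ (g y x))) (backtrack e)
  loop-gain {x} e w@(step _ (step _ _)) u = begin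
    gain (step e w)                        ≡⟨ gain-path (step e w) ⟩
    gainPairs (pairs (path (step e w)))    ≡⟨ cong gainPairs (closedPairs-loop e w) ⟨
    gainPairs (closedPairs (x ∷ starts w)) ≡⟨ cycle-gain (x ∷ starts w) (isCycle-loop e w (s≤s (s≤s z≤n)) u) ⟩
    1ω                                     ∎

  closed : ∀ {i} (w : Reach (Adj M) i i) → gain w ≡ 1ω
  closed = gain-closed loop-gain

  absSq-gain : ∀ {i j} (w : Reach (Adj M) i j) → absSq (gain w) ≡ + 1
  absSq-gain here       = refl
  absSq-gain (step {i} {j} e w) = trans (absSq-unit-* (g i j) (gain w) (unit (st M i j) e)) (absSq-gain w)
    where
    unit : ∀ s → s ≢ none → absSq (-ω nEntry s) ≡ + 1
    unit none  s≢ = contradiction refl s≢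
    unit undir _  = refl
    unit fwd   _  = refl
    unit bwd   _  = refl

  -- The diagonal of the switching. By `closed` it does not depend on which walk `conn` supplies.
  potential : Fin (suc m) → ℤω
  potential v = gain (conn zero v)

  -- The walks 0 → u → v → 0 and 0 → v → 0 are closed and share the part v → 0, so both
  -- sides are inverse to its gain.
  potential-edge : ∀ {u v} → Adj M u v → potential u *ω g u v ≡ potential v
  potential-edge {u} {v} e = begin
    s u *ω g u v                         ≡⟨ *-identityʳ (s u *ω g u v) ⟨
    s u *ω g u v *ω 1ω                   ≡⟨ cong (s u *ω g u v *ω_) (loop (conn zero v)) ⟨
    s u *ω g u v *ω (s v *ω t)           ≡⟨ regroup (s u) (g u v) (s v) t ⟩
    s u *ω (g u v *ω t) *ω s v           ≡⟨ cong (_*ω s v) (gain-++ (conn zero u) (step e (conn v zero))) ⟨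
    gain (conn zero u ++ʷ step e (conn v zero)) *ω s v  ≡⟨ cong (_*ω s v) (closed (conn zero u ++ʷ step e (conn v zero))) ⟩
    1ω *ω s v                            ≡⟨ *ω-identityˡ (s v) ⟩
    s v                                  ∎
    where
    s = potential
    t = gain (conn v zero)
    loop : ∀ (w : Reach (Adj M) zero v) → gain w *ω t ≡ 1ω
    loop w = trans (sym (gain-++ w (conn v zero))) (closed (w ++ʷ conn v zero))
    regroup : ∀ a b c d → a *ω b *ω (c *ω d) ≡ a *ω (b *ω d) *ω c
    regroup = solve-∀ ℤω-ring

  conj-potential : ∀ v → conj (potential v) *ω potential v ≡ 1ω
  conj-potential v = trans (conj-* (potential v)) (cong (λ a → mkℤω a (+ 0)) (absSq-gain (conn zero v)))

  Dmat-δ : ∀ i j → Dmat M i j ≡ δ i j *ω fromℕω (degree M i)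
  Dmat-δ i j with i ≟ j
  ... | yes refl = sym (trans (cong (_*ω fromℕω (degree M i)) (δ-refl i)) (*ω-identityˡ _))
  ... | no i≢j   = sym (trans (cong (_*ω fromℕω (degree M i)) (δ-≢ i≢j)) (zeroˡ (fromℕω (degree M i))))

  Qmat-switching : ∀ i j → Qmat M i j ≡ conj (potential i) *ω laplacian i j *ω potential j
  Qmat-switching i j = begin
    Dmat M i j +ω nEntry (st M i j)
      -- The factor `conj s *ω t` is 1 on the diagonal and the negated entry of N along an edge;
      -- elsewhere the terms it multiplies are zero.
      ≡⟨ cong₂ _+ω_ (trans (Dmat-δ i j) (diagonal D)) off-diagonal ⟩
    δ i j *ω D *ω (conj s *ω t) +ω (-ω adj i j) *ω (conj s *ω t)
      ≡⟨ factor (δ i j *ω D) (adj i j) (conj s) t ⟩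
    conj s *ω (δ i j *ω D +ω -ω adj i j) *ω t
      ≡⟨ cong (λ l → conj s *ω l *ω t) (laplacian-entry i j) ⟨
    conj s *ω laplacian i j *ω t ∎
    where
    s = potential i
    t = potential j
    D = fromℕω (degree M i)
    factor : ∀ x a c t → x *ω (c *ω t) +ω (-ω a) *ω (c *ω t) ≡ c *ω (x +ω -ω a) *ω t
    factor = solve-∀ ℤω-ring
    vanish : ∀ d x → 0ω *ω d ≡ 0ω *ω d *ω x
    vanish = solve-∀ ℤω-ring
    diagonal : ∀ d → δ i j *ω d ≡ δ i j *ω d *ω (conj s *ω t)
    diagonal d with i ≟ j
    ... | yes refl = sym (trans (cong (δ i i *ω d *ω_) (conj-potential i)) (*-identityʳ (δ i i *ω d)))
    ... | no i≢j   = subst (λ x → x *ω d ≡ x *ω d *ω (conj s *ω t)) (sym (δ-≢ i≢j)) (vanish d (conj s *ω t))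
    gain-ratio : Adj M i j → conj s *ω t ≡ g i j
    gain-ratio e = begin
      conj s *ω t              ≡⟨ cong (conj s *ω_) (potential-edge e) ⟨
      conj s *ω (s *ω g i j)   ≡⟨ *ω-assoc (conj s) s (g i j) ⟨
      conj s *ω s *ω g i j     ≡⟨ cong (_*ω g i j) (conj-potential i) ⟩
      1ω *ω g i j              ≡⟨ *ω-identityˡ (g i j) ⟩
      g i j                    ∎
    off : ∀ st′ x → (st′ ≢ none → x ≡ -ω nEntry st′) → nEntry st′ ≡ (-ω ⟦ present st′ ⟧) *ω x
    off none  x h = sym (zeroˡ x)
    off undir x h = cong ((-ω 1ω) *ω_) (sym (h λ ()))
    off fwd   x h = cong ((-ω 1ω) *ω_) (sym (h λ ()))
    off bwd   x h = cong ((-ω 1ω) *ω_) (sym (h λ ()))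
    off-diagonal : nEntry (st M i j) ≡ (-ω adj i j) *ω (conj s *ω t)
    off-diagonal = off (st M i j) (conj s *ω t) gain-ratio

  absSq-cofactor : ∀ i j → absSq (cofactor m (Qmat M) i j) ≡ absSq (cofactor m laplacian i j)
  absSq-cofactor i j = begin
    absSq (σ *ω det m (λ r c → Qmat M (punchIn i r) (punchIn j c)))
      ≡⟨ cong (λ d → absSq (σ *ω d)) (trans (det-cong m (λ r c → Qmat-switching (punchIn i r) (punchIn j c)))
                                            (det-scale m x y (λ r c → laplacian (punchIn i r) (punchIn j c)))) ⟩
    absSq (σ *ω ((prod x *ω prod y) *ω Δ))
      ≡⟨ cong absSq (swap σ (prod x) (prod y) Δ) ⟩
    absSq (prod x *ω (prod y *ω (σ *ω Δ)))
      ≡⟨ absSq-unit-* (prod x) (prod y *ω (σ *ω Δ)) (absSq-prod x (λ r → trans (absSq-conj (potential (punchIn i r))) (absSq-gain (conn zero (punchIn i r))))) ⟩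
    absSq (prod y *ω (σ *ω Δ))
      ≡⟨ absSq-unit-* (prod y) (σ *ω Δ) (absSq-prod y (λ c → absSq-gain (conn zero (punchIn j c)))) ⟩
    absSq (cofactor m laplacian i j) ∎
    where
    σ = sign (toℕ i ℕ.+ toℕ j)
    x y : Fin m → ℤω
    x r = conj (potential (punchIn i r))
    y c = potential (punchIn j c)
    Δ = det m (λ r c → laplacian (punchIn i r) (punchIn j c))
    swap : ∀ s p q d → s *ω ((p *ω q) *ω d) ≡ p *ω (q *ω (s *ω d))
    swap = solve-∀ ℤω-ring

-- The cofactors of row `ρ` are counted by trees rooted at `ρ`. Once orientations are forgotten, any
-- two roots give duplicate-free lists of the same trees, hence permutations of each other.
length-trees : ∀ {m} (M : MixedGraph (suc m)) ρ ρ′ → length (RootedTrees.trees M ρ) ≡ length (RootedTrees.trees M ρ′)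
length-trees M ρ ρ′ = ↭-length (∼bag⇒↭ (unique∧set⇒bag (T.trees-unique) (T′.trees-unique) λ {T} →
  mk⇔ (λ T∈ → Equivalence.from (T′.trees⇔spanning T) (Equivalence.to (T.trees⇔spanning T) T∈))
      (λ T∈ → Equivalence.from (T.trees⇔spanning T) (Equivalence.to (T′.trees⇔spanning T) T∈))))
  where
  module T  = RootedTrees M ρ
  module T′ = RootedTrees M ρ′

theorem3p8 : ∀ (m : ℕ) (M : MixedGraph (suc m))
    → Connected (Adj M)
    → (∀ vs → IsCycle (Adj M) vs → InΨ₄ M vs)
    → ∃ λ (trees : List (Vec (Vec Bool (suc m)) (suc m)))
    → Unique trees
    × (∀ T → (T ∈ trees) ⇔ IsSpanningTree M T)
    × (∀ (i j : Fin (suc m)) → absSq (cofactor m (Qmat M) i j) ≡ + (length trees * length trees))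
theorem3p8 m M conn cycles = trees , trees-unique , trees⇔spanning , λ i j → begin
  absSq (cofactor m (Qmat M) i j)                  ≡⟨ Switching.absSq-cofactor M conn cycles i j ⟩
  absSq (cofactor m (Laplacian.laplacian M) i j)   ≡⟨ cong absSq (Laplacian.cofactor-laplacian M i j) ⟩
  absSq (fromℕω (length (RootedTrees.trees M i)))  ≡⟨ cong (λ k → absSq (fromℕω k)) (length-trees M i zero) ⟩
  absSq (fromℕω (length trees))                    ≡⟨ absSq-fromℕω (length trees) ⟩
  + (length trees ℕ.* length trees)                ∎
  where
  open ≡-Reasoning
  open RootedTrees M zero
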